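{- Any dual linear category gives rise to a dual LNL model: if $\mathcal{L}$ is a dual linear category, then there exist a cocartesian coclosed category $\mathcal{C}$ and a symmetric comonoidal adjunction $\mathcal{L} : \mathsf{H}\dashv\mathsf{J} : \mathcal{C}$ which, together with the underlying symmetric monoidal coclosed category of $\mathcal{L}$, form a dual LNL model.
   Context: Composition is written in diagrammatic order, $f;g$. A symmetric monoidal category is written $(\mathcal{M},\perp,\oplus)$ with structural isomorphisms $\lambda_A : \perp\oplus A\to A$, $\rho_A : A\oplus\perp\to A$, $\alpha_{A,B,C} : (A\oplus B)\oplus C\to A\oplus(B\oplus C)$ and symmetry $\beta_{A,B} : A\oplus B\to B\oplus A$. It is coclosed if for every object $B$ the functor $-\oplus B$ has a specified left adjoint $(-)\mathbin{\bullet\!- }B$, i.e. $\mathrm{Hom}(C, A\oplus B)\cong \mathrm{Hom}(C\mathbin{\bullet\!- }B, A)$ naturally. A cocartesian category $(\mathcal{C},0,+)$ is a category with an initial object $0$ and binary coproducts $+$, regarded as a symmetric monoidal category; it is coclosed if it is coclosed as such (the left adjoint is written $S-T$). A symmetric comonoidal functor $(F,m)$ from $\mathcal{M}_1$ to $\mathcal{M}_2$ is a functor $F$ with a map $m_\perp : F\perp_1\to\perp_2$ and a natural transformation $m_{A,B} : F(A\oplus_1 B)\to FA\oplus_2 FB$ such that $m_{A\oplus B,C};(m_{A,B}\oplus \mathrm{id});\alpha = F\alpha; m_{A,B\oplus C};(\mathrm{id}\oplus m_{B,C})$, $m_{\perp,A};(m_\perp\oplus\mathrm{id}) = F\lambda_A;\lambda^{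 -1}_{FA}$, $m_{A,\perp};(\mathrm{id}\oplus m_\perp) = F\rho_A;\rho^{ -1}_{FA}$, and $m_{A,B};\beta = F\beta; m_{B,A}$. A symmetric comonoidal natural transformation $f:(F,m)\to(G,n)$ is a natural transformation with $m_{A,B};(f_A\oplus f_B) = f_{A\oplus B};n_{A,B}$ and $f_\perp;n_\perp = m_\perp$. Composites of symmetric comonoidal functors are symmetric comonoidal in the evident way, and the identity functor is symmetric comonoidal. A symmetric comonoidal adjunction is an adjunction between symmetric comonoidal functors whose unit and counit are symmetric comonoidal natural transformations. A symmetric comonoidal monad is a monad $(T,\eta,\mu)$ with $T$ a symmetric comonoidal endofunctor and $\eta,\mu$ symmetric comonoidal natural transformations. A dual LNL model $\mathcal{L} : \mathsf{H} \dashv \mathsf{J} : \mathcal{C}$ consists of a symmetric monoidal coclosed category $(\mathcal{L},\perp,\oplus,\bullet\!-)$, a cocartesian coclosed category $(\mathcal{C},0,+,-)$, and a symmetric comonoidal adjunction with left adjoint $\mathsf{H}:\mathcal{L}\to\mathcal{C}$ and right adjoint $\mathsf{J}:\mathcal{C}\to\mathcal{L}$. A dual linear category is a symmetric monoidal coclosed category $(\mathcal{L},\perp,\oplus,\bullet\!-)$ with a symmetric comonoidal monad $(?,\eta,\mu)$ (comonoidal structure maps $r_\perp:?\perp\to\perp$, $r_{A,B}:?(A\oplus B)\to ?A\oplus ?B$) such that: (a) each free $?$-algebra $(?A,\mu_A)$ carries naturally the structure of a commutative $\oplus$-monoid: there are distinguished symmetric comonoidal natural transformations $w_A:\perp\to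 ?A$ and $c_A:?A\oplus ?A\to ?A$ such that $(?A,w_A,c_A)$ is a commutative monoid in $(\mathcal{L},\perp,\oplus)$ and $w_A,c_A$ are $?$-algebra morphisms, where $\perp$ carries the algebra structure $r_\perp$, $?A$ carries $\mu_A$, and $?A\oplus ?A$ carries $r_{?A,?A};(\mu_A\oplus\mu_A)$. Here the source of $w$ is the constant functor $W(A)=\perp$ with comonoidal structure $\mathrm{id}_\perp$ and $\rho_\perp^{ -1}:\perp\to\perp\oplus\perp$, and the source of $c$ is the functor $A\mapsto ?A\oplus ?A$ with comonoidal structure $(r_\perp\oplus r_\perp);\lambda_\perp$ and $(r_{A,B}\oplus r_{A,B})$ followed by the canonical isomorphism $(?A\oplus ?B)\oplus(?A\oplus ?B)\cong(?A\oplus ?A)\oplus(?B\oplus ?B)$; (b) whenever $f:(?A,\mu_A)\to(?B,\mu_B)$ is a morphism of free $?$-algebras, it is also a monoid morphism, i.e. $w_A;f=w_B$ and $c_A;f=(f\oplus f);c_B$. -}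

{-# OPTIONS --safe #-}
module Defs where

open import Level using (Level; suc; _⊔_)
open import Relation.Binary using (Rel; IsEquivalence; Setoid)
import Relation.Binary.Reasoning.Setoid as SetoidReasoning

private
  variable
    o ℓ e o′ ℓ′ e′ o″ ℓ″ e″ : Level

-- Hom-sets are setoids, and composition is in diagrammatic order:
-- f ⨾ g is "first f, then g".

record Category (o ℓ e : Level) : Set (suc (o ⊔ ℓ ⊔ e)) where
  infix  4 _≈_ _⇒_
  infixl 8 _⨾_
  field
    Obj : Set o
    _⇒_ : Rel Obj ℓ
    _≈_ : ∀ {A B} → Rel (A ⇒ B) e
    id  : ∀ {A} → A ⇒ A
    _⨾_ : ∀ {A B C} → A ⇒ B → B ⇒ C → A ⇒ C

    equiv     : ∀ {A B} → IsEquivalence (_≈_ {A} {B})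
    ⨾-cong    : ∀ {A B C} {f f′ : A ⇒ B} {g g′ : B ⇒ C} →
                f ≈ f′ → g ≈ g′ → f ⨾ g ≈ f′ ⨾ g′
    identityˡ : ∀ {A B} {f : A ⇒ B} → id ⨾ f ≈ f
    identityʳ : ∀ {A B} {f : A ⇒ B} → f ⨾ id ≈ f
    assoc     : ∀ {A B C D} {f : A ⇒ B} {g : B ⇒ C} {h : C ⇒ D} →
                (f ⨾ g) ⨾ h ≈ f ⨾ (g ⨾ h)

  module Equiv {A B : Obj} = IsEquivalence (equiv {A} {B})

  homSetoid : (A B : Obj) → Setoid ℓ e
  homSetoid A B = record { Carrier = A ⇒ B ; _≈_ = _≈_ ; isEquivalence = equiv }

  module HomReasoning {A B : Obj} = SetoidReasoning (homSetoid A B)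

  ⨾-congˡ : ∀ {A B C} {f : A ⇒ B} {g g′ : B ⇒ C} → g ≈ g′ → f ⨾ g ≈ f ⨾ g′
  ⨾-congˡ = ⨾-cong Equiv.refl

  ⨾-congʳ : ∀ {A B C} {f f′ : A ⇒ B} {g : B ⇒ C} → f ≈ f′ → f ⨾ g ≈ f′ ⨾ g
  ⨾-congʳ p = ⨾-cong p Equiv.refl

  infix 4 _≅_
  record _≅_ (A B : Obj) : Set (ℓ ⊔ e) where
    field
      from : A ⇒ B
      to   : B ⇒ A
      isoˡ : from ⨾ to ≈ id
      isoʳ : to ⨾ from ≈ id

record Functor (C : Category o ℓ e) (D : Category o′ ℓ′ e′)
       : Set (o ⊔ ℓ ⊔ e ⊔ o′ ⊔ ℓ′ ⊔ e′) where
  private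
    module C = Category C
    module D = Category D
  field
    F₀ : C.Obj → D.Obj
    F₁ : ∀ {A B} → A C.⇒ B → F₀ A D.⇒ F₀ B

    F-cong       : ∀ {A B} {f g : A C.⇒ B} → f C.≈ g → F₁ f D.≈ F₁ g
    identity     : ∀ {A} → F₁ (C.id {A}) D.≈ D.id
    homomorphism : ∀ {A B C} {f : A C.⇒ B} {g : B C.⇒ C} →
                   F₁ (f C.⨾ g) D.≈ F₁ f D.⨾ F₁ g

idFunctor : (C : Category o ℓ e) → Functor C C
idFunctor C = record
  { F₀ = λ A → A
  ; F₁ = λ f → f
  ; F-cong = λ p → p
  ; identity = Equiv.refl
  ; homomorphism = Equiv.refl
  } where open Category C

constFunctor : (C : Category o ℓ e) (D : Category o′ ℓ′ e′) → Category.Obj D → Functor C D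
constFunctor C D X = record
  { F₀ = λ _ → X
  ; F₁ = λ _ → id
  ; F-cong = λ _ → Equiv.refl
  ; identity = Equiv.refl
  ; homomorphism = Equiv.sym identityˡ
  } where open Category D

infixl 9 _⨾F_
_⨾F_ : {C : Category o ℓ e} {D : Category o′ ℓ′ e′} {E : Category o″ ℓ″ e″} →
       Functor C D → Functor D E → Functor C E
_⨾F_ {E = E} F G = record
  { F₀ = λ A → G.F₀ (F.F₀ A)
  ; F₁ = λ f → G.F₁ (F.F₁ f)
  ; F-cong = λ p → G.F-cong (F.F-cong p)
  ; identity = Equiv.trans (G.F-cong F.identity) G.identity
  ; homomorphism = Equiv.trans (G.F-cong F.homomorphism) G.homomorphism
  }
  where
    open Category E
    module F = Functor F
    module G = Functor G

record NaturalTransformation {C : Category o ℓ e} {D : Category o′ ℓ′ e′} (F G : Functor C D)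
       : Set (o ⊔ ℓ ⊔ ℓ′ ⊔ e′) where
  private
    module C = Category C
    module F = Functor F
    module G = Functor G
  open Category D
  field
    η       : ∀ A → F.F₀ A ⇒ G.F₀ A
    natural : ∀ {A B} (f : A C.⇒ B) → F.F₁ f ⨾ η B ≈ η A ⨾ G.F₁ f

infix 4 _⊣_
record _⊣_ {C : Category o ℓ e} {D : Category o′ ℓ′ e′} (L : Functor C D) (R : Functor D C)
       : Set (o ⊔ ℓ ⊔ e ⊔ o′ ⊔ ℓ′ ⊔ e′) where
  private
    module C = Category C
    module D = Category D
    module L = Functor L
    module R = Functor R
  field
    unit   : NaturalTransformation (idFunctor C) (L ⨾F R)
    counit : NaturalTransformation (R ⨾F L) (idFunctor D)

  module unit   = NaturalTransformation unit
  module counit = NaturalTransformation counit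

  field
    zig : ∀ {A} → L.F₁ (unit.η A) D.⨾ counit.η (L.F₀ A) D.≈ D.id
    zag : ∀ {B} → unit.η (R.F₀ B) C.⨾ R.F₁ (counit.η B) C.≈ C.id

record SymmetricMonoidal (C : Category o ℓ e) : Set (o ⊔ ℓ ⊔ e) where
  open Category C
  infixr 10 _⊕_ _⊕₁_
  field
    ⊥    : Obj
    _⊕_  : Obj → Obj → Obj
    _⊕₁_ : ∀ {A A′ B B′} → A ⇒ A′ → B ⇒ B′ → A ⊕ B ⇒ A′ ⊕ B′

    ⊕-cong         : ∀ {A A′ B B′} {f f′ : A ⇒ A′} {g g′ : B ⇒ B′} →
                     f ≈ f′ → g ≈ g′ → f ⊕₁ g ≈ f′ ⊕₁ g′
    ⊕-identity     : ∀ {A B} → id {A} ⊕₁ id {B} ≈ id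
    ⊕-homomorphism : ∀ {A A′ A″ B B′ B″}
                     {f : A ⇒ A′} {f′ : A′ ⇒ A″} {g : B ⇒ B′} {g′ : B′ ⇒ B″} →
                     (f ⨾ f′) ⊕₁ (g ⨾ g′) ≈ (f ⊕₁ g) ⨾ (f′ ⊕₁ g′)

    unitorˡ    : ∀ A → ⊥ ⊕ A ≅ A
    unitorʳ    : ∀ A → A ⊕ ⊥ ≅ A
    associator : ∀ A B C → (A ⊕ B) ⊕ C ≅ A ⊕ (B ⊕ C)
    β          : ∀ A B → A ⊕ B ⇒ B ⊕ A

  λ⇒ : ∀ A → ⊥ ⊕ A ⇒ A
  λ⇒ A = _≅_.from (unitorˡ A)
  λ⇐ : ∀ A → A ⇒ ⊥ ⊕ A
  λ⇐ A = _≅_.to (unitorˡ A)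
  ρ⇒ : ∀ A → A ⊕ ⊥ ⇒ A
  ρ⇒ A = _≅_.from (unitorʳ A)
  ρ⇐ : ∀ A → A ⇒ A ⊕ ⊥
  ρ⇐ A = _≅_.to (unitorʳ A)
  α⇒ : ∀ A B C → (A ⊕ B) ⊕ C ⇒ A ⊕ (B ⊕ C)
  α⇒ A B C = _≅_.from (associator A B C)
  α⇐ : ∀ A B C → A ⊕ (B ⊕ C) ⇒ (A ⊕ B) ⊕ C
  α⇐ A B C = _≅_.to (associator A B C)

  -- Mac Lane's axioms; λ⊥≈ρ⊥ and β-unit are known to follow from the others.
  field
    λ-natural : ∀ {A B} (f : A ⇒ B) → (id ⊕₁ f) ⨾ λ⇒ B ≈ λ⇒ A ⨾ f
    ρ-natural : ∀ {A B} (f : A ⇒ B) → (f ⊕₁ id) ⨾ ρ⇒ B ≈ ρ⇒ A ⨾ f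
    α-natural : ∀ {A A′ B B′ C C′} (f : A ⇒ A′) (g : B ⇒ B′) (h : C ⇒ C′) →
                ((f ⊕₁ g) ⊕₁ h) ⨾ α⇒ A′ B′ C′ ≈ α⇒ A B C ⨾ (f ⊕₁ (g ⊕₁ h))
    β-natural : ∀ {A A′ B B′} (f : A ⇒ A′) (g : B ⇒ B′) →
                (f ⊕₁ g) ⨾ β A′ B′ ≈ β A B ⨾ (g ⊕₁ f)
    triangle  : ∀ {A B} → α⇒ A ⊥ B ⨾ (id ⊕₁ λ⇒ B) ≈ ρ⇒ A ⊕₁ id
    pentagon  : ∀ {A B C D} →
                (α⇒ A B C ⊕₁ id) ⨾ α⇒ A (B ⊕ C) D ⨾ (id ⊕₁ α⇒ B C D)
                  ≈ α⇒ (A ⊕ B) C D ⨾ α⇒ A B (C ⊕ D)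
    λ⊥≈ρ⊥     : λ⇒ ⊥ ≈ ρ⇒ ⊥
    β-inverse : ∀ {A B} → β A B ⨾ β B A ≈ id
    β-unit    : ∀ {A} → β A ⊥ ⨾ λ⇒ A ≈ ρ⇒ A
    hexagon   : ∀ {A B C} →
                (β A B ⊕₁ id) ⨾ α⇒ B A C ⨾ (id ⊕₁ β A C)
                  ≈ α⇒ A B C ⨾ β A (B ⊕ C) ⨾ α⇒ B C A

  interchange : ∀ A B C D → (A ⊕ B) ⊕ (C ⊕ D) ⇒ (A ⊕ C) ⊕ (B ⊕ D)
  interchange A B C D =
    α⇒ A B (C ⊕ D)
      ⨾ (id ⊕₁ (α⇐ B C D ⨾ (β B C ⊕₁ id) ⨾ α⇒ C B D))
      ⨾ α⇐ A C (B ⊕ D)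

  -⊕_ : Obj → Functor C C
  -⊕ B = record
    { F₀ = λ A → A ⊕ B
    ; F₁ = λ f → f ⊕₁ id
    ; F-cong = λ p → ⊕-cong p Equiv.refl
    ; identity = ⊕-identity
    ; homomorphism = Equiv.trans (⊕-cong Equiv.refl (Equiv.sym identityˡ)) ⊕-homomorphism
    }

record SymmetricMonoidalCategory (o ℓ e : Level) : Set (suc (o ⊔ ℓ ⊔ e)) where
  field
    U                 : Category o ℓ e
    symmetricMonoidal : SymmetricMonoidal U

  open Category U public
  open SymmetricMonoidal symmetricMonoidal public

record Coclosed (M : SymmetricMonoidalCategory o ℓ e) : Set (o ⊔ ℓ ⊔ e) where
  open SymmetricMonoidalCategory M
  -- F₀ (-• B) A is the internal cohom A •– B.
  field
    -•_     : Obj → Functor U U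
    adjoint : ∀ B → (-• B) ⊣ (-⊕ B)

record SymmetricMonoidalCoclosedCategory (o ℓ e : Level) : Set (suc (o ⊔ ℓ ⊔ e)) where
  field
    symmetricMonoidalCategory : SymmetricMonoidalCategory o ℓ e
    coclosed                  : Coclosed symmetricMonoidalCategory

record Cocartesian (C : Category o ℓ e) : Set (o ⊔ ℓ ⊔ e) where
  open Category C
  infixr 10 _+_
  field
    𝟎        : Obj
    ¡        : ∀ {A} → 𝟎 ⇒ A
    ¡-unique : ∀ {A} (f : 𝟎 ⇒ A) → ¡ ≈ f

    _+_     : Obj → Obj → Obj
    i₁      : ∀ {A B} → A ⇒ A + B
    i₂      : ∀ {A B} → B ⇒ A + B
    [_,_]   : ∀ {A B X} → A ⇒ X → B ⇒ X → A + B ⇒ X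
    inject₁ : ∀ {A B X} {f : A ⇒ X} {g : B ⇒ X} → i₁ ⨾ [ f , g ] ≈ f
    inject₂ : ∀ {A B X} {f : A ⇒ X} {g : B ⇒ X} → i₂ ⨾ [ f , g ] ≈ g
    unique  : ∀ {A B X} {f : A ⇒ X} {g : B ⇒ X} {h : A + B ⇒ X} →
              i₁ ⨾ h ≈ f → i₂ ⨾ h ≈ g → [ f , g ] ≈ h

record CocartesianCategory (o ℓ e : Level) : Set (suc (o ⊔ ℓ ⊔ e)) where
  field
    U           : Category o ℓ e
    cocartesian : Cocartesian U

  open Category U public
  open Cocartesian cocartesian public

module _ {C : Category o ℓ e} (cocartesian : Cocartesian C) where
  open Category C
  open Cocartesian cocartesian
  open Equiv

  private
    infixr 4 _∙_
    _∙_ : ∀ {A B} {f g h : A ⇒ B} → f ≈ g → g ≈ h → f ≈ h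
    _∙_ = trans

    variable
      A A′ B B′ D X Y : Obj

    -- Equations between maps out of coproducts are checked on generalised
    -- elements x ⨾ i₁ and x ⨾ i₂.

    at₁ : {x : X ⇒ A} {f : A ⇒ Y} {g : B ⇒ Y} → (x ⨾ i₁) ⨾ [ f , g ] ≈ x ⨾ f
    at₁ = assoc ∙ ⨾-congˡ inject₁

    at₂ : {x : X ⇒ B} {f : A ⇒ Y} {g : B ⇒ Y} → (x ⨾ i₂) ⨾ [ f , g ] ≈ x ⨾ g
    at₂ = assoc ∙ ⨾-congˡ inject₂

    at𝟎 : {x : X ⇒ 𝟎} {i : 𝟎 ⇒ A} {h k : A ⇒ Y} → (x ⨾ i) ⨾ h ≈ (x ⨾ i) ⨾ k
    at𝟎 = assoc ∙ ⨾-congˡ (sym (¡-unique _) ∙ ¡-unique _) ∙ sym assoc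

    ext : {h k : A + B ⇒ Y} →
          (∀ {X} {x : X ⇒ A} → (x ⨾ i₁) ⨾ h ≈ (x ⨾ i₁) ⨾ k) →
          (∀ {X} {x : X ⇒ B} → (x ⨾ i₂) ⨾ h ≈ (x ⨾ i₂) ⨾ k) → h ≈ k
    ext p q = sym (unique (bare p) (bare q)) ∙ unique refl refl
      where
      bare : {i : A ⇒ B} {h k : B ⇒ Y} → (id ⨾ i) ⨾ h ≈ (id ⨾ i) ⨾ k → i ⨾ h ≈ i ⨾ k
      bare p = ⨾-congʳ (sym identityˡ) ∙ p ∙ ⨾-congʳ identityˡ

    infixl 5 _▸_
    _▸_ : {x : X ⇒ A} {f : A ⇒ B} {y : X ⇒ B} {g : B ⇒ Y} {z : X ⇒ Y} →
          x ⨾ f ≈ y → y ⨾ g ≈ z → x ⨾ (f ⨾ g) ≈ z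
    p ▸ q = sym assoc ∙ ⨾-congʳ p ∙ q

    infixr 10 _+₁_
    _+₁_ : A ⇒ A′ → B ⇒ B′ → A + B ⇒ A′ + B′
    f +₁ g = [ f ⨾ i₁ , g ⨾ i₂ ]

    +₁-at₁ : {f : A ⇒ A′} {g : B ⇒ B′} {x : X ⇒ A} {y : X ⇒ A′} →
             x ⨾ f ≈ y → (x ⨾ i₁) ⨾ (f +₁ g) ≈ y ⨾ i₁
    +₁-at₁ p = at₁ ∙ sym assoc ∙ ⨾-congʳ p

    +₁-at₂ : {f : A ⇒ A′} {g : B ⇒ B′} {x : X ⇒ B} {y : X ⇒ B′} →
             x ⨾ g ≈ y → (x ⨾ i₂) ⨾ (f +₁ g) ≈ y ⨾ i₂
    +₁-at₂ p = at₂ ∙ sym assoc ∙ ⨾-congʳ p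

    αC : ∀ A B D → (A + B) + D ⇒ A + (B + D)
    αC A B D = [ [ i₁ , i₁ ⨾ i₂ ] , i₂ ⨾ i₂ ]

    α-at₁₁ : {x : X ⇒ A} → ((x ⨾ i₁) ⨾ i₁) ⨾ αC A B D ≈ x ⨾ i₁
    α-at₁₁ = at₁ ∙ at₁

    α-at₁₂ : {x : X ⇒ B} → ((x ⨾ i₂) ⨾ i₁) ⨾ αC A B D ≈ (x ⨾ i₁) ⨾ i₂
    α-at₁₂ = at₁ ∙ at₂ ∙ sym assoc

    α-at₂ : {x : X ⇒ D} → (x ⨾ i₂) ⨾ αC A B D ≈ (x ⨾ i₂) ⨾ i₂
    α-at₂ = at₂ ∙ sym assoc

    α⁻¹C : ∀ A B D → A + (B + D) ⇒ (A + B) + D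
    α⁻¹C A B D = [ i₁ ⨾ i₁ , [ i₂ ⨾ i₁ , i₂ ] ]

    α⁻¹-at₁ : {x : X ⇒ A} → (x ⨾ i₁) ⨾ α⁻¹C A B D ≈ (x ⨾ i₁) ⨾ i₁
    α⁻¹-at₁ = at₁ ∙ sym assoc

    α⁻¹-at₂₁ : {x : X ⇒ B} → ((x ⨾ i₁) ⨾ i₂) ⨾ α⁻¹C A B D ≈ (x ⨾ i₂) ⨾ i₁
    α⁻¹-at₂₁ = at₂ ∙ at₁ ∙ sym assoc

    α⁻¹-at₂₂ : {x : X ⇒ D} → ((x ⨾ i₂) ⨾ i₂) ⨾ α⁻¹C A B D ≈ x ⨾ i₂
    α⁻¹-at₂₂ = at₂ ∙ at₂

    over : {x : X ⇒ A} {i : A ⇒ B} {h k : B ⇒ Y} →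
           (x ⨾ i) ⨾ h ≈ (x ⨾ i) ⨾ k → x ⨾ (i ⨾ h) ≈ x ⨾ (i ⨾ k)
    over p = sym assoc ∙ p ∙ assoc

    under : {x : X ⇒ A} {i : A ⇒ B} {h k : B ⇒ Y} →
            i ⨾ h ≈ i ⨾ k → (x ⨾ i) ⨾ h ≈ (x ⨾ i) ⨾ k
    under p = assoc ∙ ⨾-congˡ p ∙ sym assoc

    ext-l : {h k : (A + B) + D ⇒ Y} →
            (∀ {X} {x : X ⇒ A} → ((x ⨾ i₁) ⨾ i₁) ⨾ h ≈ ((x ⨾ i₁) ⨾ i₁) ⨾ k) →
            (∀ {X} {x : X ⇒ B} → ((x ⨾ i₂) ⨾ i₁) ⨾ h ≈ ((x ⨾ i₂) ⨾ i₁) ⨾ k) →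
            (∀ {X} {x : X ⇒ D} → (x ⨾ i₂) ⨾ h ≈ (x ⨾ i₂) ⨾ k) → h ≈ k
    ext-l p q r = ext (under (ext (over p) (over q))) r

    ext-r : {h k : A + (B + D) ⇒ Y} →
            (∀ {X} {x : X ⇒ A} → (x ⨾ i₁) ⨾ h ≈ (x ⨾ i₁) ⨾ k) →
            (∀ {X} {x : X ⇒ B} → ((x ⨾ i₁) ⨾ i₂) ⨾ h ≈ ((x ⨾ i₁) ⨾ i₂) ⨾ k) →
            (∀ {X} {x : X ⇒ D} → ((x ⨾ i₂) ⨾ i₂) ⨾ h ≈ ((x ⨾ i₂) ⨾ i₂) ⨾ k) → h ≈ k
    ext-r p q r = ext p (under (ext (over q) (over r)))

  cocartesian⇒symmetricMonoidal : SymmetricMonoidal C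
  cocartesian⇒symmetricMonoidal = record
    { ⊥ = 𝟎
    ; _⊕_ = _+_
    ; _⊕₁_ = λ f g → [ f ⨾ i₁ , g ⨾ i₂ ]
    ; ⊕-cong = λ p q → ext
        (+₁-at₁ (⨾-congˡ p) ∙ sym (+₁-at₁ refl))
        (+₁-at₂ (⨾-congˡ q) ∙ sym (+₁-at₂ refl))
    ; ⊕-identity = ext
        (+₁-at₁ identityʳ ∙ sym identityʳ)
        (+₁-at₂ identityʳ ∙ sym identityʳ)
    ; ⊕-homomorphism = ext
        (+₁-at₁ (sym assoc) ∙ sym (+₁-at₁ refl ▸ +₁-at₁ refl))
        (+₁-at₂ (sym assoc) ∙ sym (+₁-at₂ refl ▸ +₁-at₂ refl))
    ; unitorˡ = λ A → record
        { from = [ ¡ , id ]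
        ; to   = i₂
        ; isoˡ = ext at𝟎 ((at₂ ▸ ⨾-congʳ identityʳ) ∙ sym identityʳ)
        ; isoʳ = inject₂
        }
    ; unitorʳ = λ A → record
        { from = [ id , ¡ ]
        ; to   = i₁
        ; isoˡ = ext ((at₁ ▸ ⨾-congʳ identityʳ) ∙ sym identityʳ) at𝟎
        ; isoʳ = inject₁
        }
    ; associator = λ A B D → record
        { from = [ [ i₁ , i₁ ⨾ i₂ ] , i₂ ⨾ i₂ ]
        ; to   = [ i₁ ⨾ i₁ , [ i₂ ⨾ i₁ , i₂ ] ]
        ; isoˡ = ext-l
            ((α-at₁₁ ▸ α⁻¹-at₁) ∙ sym identityʳ)
            ((α-at₁₂ ▸ α⁻¹-at₂₁) ∙ sym identityʳ)
            ((α-at₂ ▸ α⁻¹-at₂₂) ∙ sym identityʳ)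
        ; isoʳ = ext-r
            ((α⁻¹-at₁ ▸ α-at₁₁) ∙ sym identityʳ)
            ((α⁻¹-at₂₁ ▸ α-at₁₂) ∙ sym identityʳ)
            ((α⁻¹-at₂₂ ▸ α-at₂) ∙ sym identityʳ)
        }
    ; β = λ A B → [ i₂ , i₁ ]
    ; λ-natural = λ f → ext
        at𝟎
        ((+₁-at₂ refl ▸ at₂ ∙ identityʳ) ∙ sym (at₂ ▸ ⨾-congʳ identityʳ))
    ; ρ-natural = λ f → ext
        ((+₁-at₁ refl ▸ at₁ ∙ identityʳ) ∙ sym (at₁ ▸ ⨾-congʳ identityʳ))
        at𝟎
    ; α-natural = λ f g h → ext-l
        ((+₁-at₁ (+₁-at₁ refl) ▸ α-at₁₁) ∙ sym (α-at₁₁ ▸ +₁-at₁ refl))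
        ((+₁-at₁ (+₁-at₂ refl) ▸ α-at₁₂) ∙ sym (α-at₁₂ ▸ +₁-at₂ (+₁-at₁ refl)))
        ((+₁-at₂ refl ▸ α-at₂) ∙ sym (α-at₂ ▸ +₁-at₂ (+₁-at₂ refl)))
    ; β-natural = λ f g → ext
        ((+₁-at₁ refl ▸ at₁) ∙ sym (at₁ ▸ +₁-at₂ refl))
        ((+₁-at₂ refl ▸ at₂) ∙ sym (at₂ ▸ +₁-at₁ refl))
    ; triangle = ext-l
        ((α-at₁₁ ▸ +₁-at₁ identityʳ) ∙ sym (+₁-at₁ (at₁ ∙ identityʳ)))
        (⨾-congʳ assoc ∙ at𝟎 ∙ ⨾-congʳ (sym assoc))
        ((α-at₂ ▸ +₁-at₂ at₂) ∙ sym (+₁-at₂ refl))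
    ; pentagon = ext
        (under (ext-l
          (over ((+₁-at₁ α-at₁₁ ▸ α-at₁₁ ▸ +₁-at₁ identityʳ) ∙ sym (α-at₁₁ ▸ α-at₁₁)))
          (over ((+₁-at₁ α-at₁₂ ▸ α-at₁₂ ▸ +₁-at₂ α-at₁₁) ∙ sym (α-at₁₁ ▸ α-at₁₂)))
          (over ((+₁-at₁ α-at₂ ▸ α-at₁₂ ▸ +₁-at₂ α-at₁₂) ∙ sym (α-at₁₂ ▸ α-at₂)))))
        ((+₁-at₂ identityʳ ▸ α-at₂ ▸ +₁-at₂ α-at₂) ∙ sym (α-at₂ ▸ α-at₂))
    ; λ⊥≈ρ⊥ = ext at𝟎 at𝟎
    ; β-inverse = ext
        ((at₁ ▸ at₂) ∙ sym identityʳ)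
        ((at₂ ▸ at₁) ∙ sym identityʳ)
    ; β-unit = ext
        ((at₁ ▸ at₂) ∙ sym at₁)
        at𝟎
    ; hexagon = ext-l
        ((+₁-at₁ at₁ ▸ α-at₁₂ ▸ +₁-at₂ at₁) ∙ sym (α-at₁₁ ▸ at₁ ▸ α-at₂))
        ((+₁-at₁ at₂ ▸ α-at₁₁ ▸ +₁-at₁ identityʳ) ∙ sym (α-at₁₂ ▸ at₂ ▸ α-at₁₁))
        ((+₁-at₂ identityʳ ▸ α-at₂ ▸ +₁-at₂ at₂) ∙ sym (α-at₂ ▸ at₂ ▸ α-at₁₂))
    }

cocartesianMonoidal : CocartesianCategory o ℓ e → SymmetricMonoidalCategory o ℓ e
cocartesianMonoidal C = record
  { U = CocartesianCategory.U C
  ; symmetricMonoidal = cocartesian⇒symmetricMonoidal (CocartesianCategory.cocartesian C)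
  }

record CocartesianCoclosedCategory (o ℓ e : Level) : Set (suc (o ⊔ ℓ ⊔ e)) where
  field
    cocartesianCategory : CocartesianCategory o ℓ e

  symmetricMonoidalCategory : SymmetricMonoidalCategory o ℓ e
  symmetricMonoidalCategory = cocartesianMonoidal cocartesianCategory

  field
    coclosed : Coclosed symmetricMonoidalCategory

-- A functor with the two structure maps of a comonoidal functor but no axioms:
-- enough to state what it means for a transformation to be comonoidal.
record ComonoidalData (M : SymmetricMonoidalCategory o ℓ e)
                      (N : SymmetricMonoidalCategory o′ ℓ′ e′)
       : Set (o ⊔ ℓ ⊔ e ⊔ o′ ⊔ ℓ′ ⊔ e′) where
  private
    module M = SymmetricMonoidalCategory M
    module N = SymmetricMonoidalCategory N
  field
    functor : Functor M.U N.U

  open Functor functor public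

  field
    m⊥ : F₀ M.⊥ N.⇒ N.⊥
    m  : ∀ A B → F₀ (A M.⊕ B) N.⇒ F₀ A N.⊕ F₀ B

idData : (M : SymmetricMonoidalCategory o ℓ e) → ComonoidalData M M
idData M = record { functor = idFunctor U ; m⊥ = id ; m = λ _ _ → id }
  where open SymmetricMonoidalCategory M

infixl 9 _⨾D_
_⨾D_ : {M : SymmetricMonoidalCategory o ℓ e} {N : SymmetricMonoidalCategory o′ ℓ′ e′}
       {P : SymmetricMonoidalCategory o″ ℓ″ e″} →
       ComonoidalData M N → ComonoidalData N P → ComonoidalData M P
_⨾D_ {P = P} F G = record
  { functor = F.functor ⨾F G.functor
  ; m⊥ = G.F₁ F.m⊥ ⨾ G.m⊥
  ; m = λ A B → G.F₁ (F.m A B) ⨾ G.m (F.F₀ A) (F.F₀ B)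
  }
  where
  open SymmetricMonoidalCategory P
  module F = ComonoidalData F
  module G = ComonoidalData G

record SymmetricComonoidalFunctor (M : SymmetricMonoidalCategory o ℓ e)
                                  (N : SymmetricMonoidalCategory o′ ℓ′ e′)
       : Set (o ⊔ ℓ ⊔ e ⊔ o′ ⊔ ℓ′ ⊔ e′) where
  private
    module M = SymmetricMonoidalCategory M
  open SymmetricMonoidalCategory N
  field
    comonoidalData : ComonoidalData M N

  open ComonoidalData comonoidalData public

  field
    m-natural : ∀ {A A′ B B′} (f : A M.⇒ A′) (g : B M.⇒ B′) →
                F₁ (f M.⊕₁ g) ⨾ m A′ B′ ≈ m A B ⨾ (F₁ f ⊕₁ F₁ g)
    m-assoc   : ∀ {A B C} →
                m (A M.⊕ B) C ⨾ (m A B ⊕₁ id) ⨾ α⇒ (F₀ A) (F₀ B) (F₀ C)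
                  ≈ F₁ (M.α⇒ A B C) ⨾ m A (B M.⊕ C) ⨾ (id ⊕₁ m B C)
    m-unitˡ   : ∀ {A} → m M.⊥ A ⨾ (m⊥ ⊕₁ id) ≈ F₁ (M.λ⇒ A) ⨾ λ⇐ (F₀ A)
    m-unitʳ   : ∀ {A} → m A M.⊥ ⨾ (id ⊕₁ m⊥) ≈ F₁ (M.ρ⇒ A) ⨾ ρ⇐ (F₀ A)
    m-sym     : ∀ {A B} → m A B ⨾ β (F₀ A) (F₀ B) ≈ F₁ (M.β A B) ⨾ m B A

record IsComonoidalTransformation
         {M : SymmetricMonoidalCategory o ℓ e} {N : SymmetricMonoidalCategory o′ ℓ′ e′}
         (F G : ComonoidalData M N)
         (f : NaturalTransformation (ComonoidalData.functor F) (ComonoidalData.functor G))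
       : Set (o ⊔ e′) where
  private
    module M = SymmetricMonoidalCategory M
    module F = ComonoidalData F
    module G = ComonoidalData G
  open SymmetricMonoidalCategory N
  open NaturalTransformation f
  field
    preserves-m  : ∀ {A B} → F.m A B ⨾ (η A ⊕₁ η B) ≈ η (A M.⊕ B) ⨾ G.m A B
    preserves-m⊥ : η M.⊥ ⨾ G.m⊥ ≈ F.m⊥

record SymmetricComonoidalAdjunction (M : SymmetricMonoidalCategory o ℓ e)
                                     (N : SymmetricMonoidalCategory o′ ℓ′ e′)
       : Set (o ⊔ ℓ ⊔ e ⊔ o′ ⊔ ℓ′ ⊔ e′) where
  field
    H : SymmetricComonoidalFunctor M N
    J : SymmetricComonoidalFunctor N M

  module H = SymmetricComonoidalFunctor H
  module J = SymmetricComonoidalFunctor J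

  field
    adjunction : H.functor ⊣ J.functor

  open _⊣_ adjunction public

  field
    unit-comonoidal   : IsComonoidalTransformation
                          (idData M) (H.comonoidalData ⨾D J.comonoidalData) unit
    counit-comonoidal : IsComonoidalTransformation
                          (J.comonoidalData ⨾D H.comonoidalData) (idData N) counit

record SymmetricComonoidalMonad (M : SymmetricMonoidalCategory o ℓ e) : Set (o ⊔ ℓ ⊔ e) where
  open SymmetricMonoidalCategory M
  field
    T : SymmetricComonoidalFunctor M M

  module T = SymmetricComonoidalFunctor T

  field
    unit : NaturalTransformation (idFunctor U) T.functor
    mult : NaturalTransformation (T.functor ⨾F T.functor) T.functor

  open NaturalTransformation unit public using (η) renaming (natural to η-natural)
  open NaturalTransformation mult public using () renaming (η to μ; natural to μ-natural)

  field
    μ-assoc     : ∀ {A} → T.F₁ (μ A) ⨾ μ A ≈ μ (T.F₀ A) ⨾ μ A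
    μ-identityˡ : ∀ {A} → η (T.F₀ A) ⨾ μ A ≈ id
    μ-identityʳ : ∀ {A} → T.F₁ (η A) ⨾ μ A ≈ id

    η-comonoidal : IsComonoidalTransformation (idData M) T.comonoidalData unit
    μ-comonoidal : IsComonoidalTransformation
                     (T.comonoidalData ⨾D T.comonoidalData) T.comonoidalData mult

module _ {M : SymmetricMonoidalCategory o ℓ e} (monad : SymmetricComonoidalMonad M) where
  open SymmetricMonoidalCategory M
  open SymmetricComonoidalMonad monad
  open IsComonoidalTransformation
  open Equiv
  open HomReasoning

  record Algebra : Set (o ⊔ ℓ ⊔ e) where
    field
      carrier     : Obj
      action      : T.F₀ carrier ⇒ carrier
      action-unit : η carrier ⨾ action ≈ id
      action-mult : T.F₁ action ⨾ action ≈ μ carrier ⨾ action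

  record IsAlgebraMorphism (X Y : Algebra) (f : Algebra.carrier X ⇒ Algebra.carrier Y)
         : Set e where
    private
      module X = Algebra X
      module Y = Algebra Y
    field
      commutes : T.F₁ f ⨾ Y.action ≈ X.action ⨾ f

  freeAlgebra : Obj → Algebra
  freeAlgebra A = record
    { carrier = T.F₀ A
    ; action = μ A
    ; action-unit = μ-identityˡ
    ; action-mult = μ-assoc
    }

  ⊥-algebra : Algebra
  ⊥-algebra = record
    { carrier = ⊥
    ; action = T.m⊥
    ; action-unit = preserves-m⊥ η-comonoidal
    ; action-mult = sym (preserves-m⊥ μ-comonoidal)
    }

  ⊕-algebra : Algebra → Algebra → Algebra
  ⊕-algebra X Y = record
    { carrier = X.carrier ⊕ Y.carrier
    ; action = T.m X.carrier Y.carrier ⨾ (X.action ⊕₁ Y.action)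
    ; action-unit = begin
        η _ ⨾ (T.m _ _ ⨾ (X.action ⊕₁ Y.action))     ≈⟨ sym assoc ⟩
        (η _ ⨾ T.m _ _) ⨾ (X.action ⊕₁ Y.action)     ≈⟨ ⨾-congʳ (sym (preserves-m η-comonoidal)) ⟩
        (id ⨾ (η _ ⊕₁ η _)) ⨾ (X.action ⊕₁ Y.action) ≈⟨ ⨾-congʳ identityˡ ⟩
        (η _ ⊕₁ η _) ⨾ (X.action ⊕₁ Y.action)        ≈⟨ sym ⊕-homomorphism ⟩
        (η _ ⨾ X.action) ⊕₁ (η _ ⨾ Y.action)         ≈⟨ ⊕-cong X.action-unit Y.action-unit ⟩
        id ⊕₁ id                                     ≈⟨ ⊕-identity ⟩
        id                                           ∎
    ; action-mult = begin
        T.F₁ (T.m _ _ ⨾ (X.action ⊕₁ Y.action)) ⨾ (T.m _ _ ⨾ (X.action ⊕₁ Y.action))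
          ≈⟨ ⨾-congʳ T.homomorphism ⟩
        (T.F₁ (T.m _ _) ⨾ T.F₁ (X.action ⊕₁ Y.action)) ⨾ (T.m _ _ ⨾ (X.action ⊕₁ Y.action))
          ≈⟨ trans assoc (⨾-congˡ (sym assoc)) ⟩
        T.F₁ (T.m _ _) ⨾ ((T.F₁ (X.action ⊕₁ Y.action) ⨾ T.m _ _) ⨾ (X.action ⊕₁ Y.action))
          ≈⟨ ⨾-congˡ (⨾-congʳ (T.m-natural X.action Y.action)) ⟩
        T.F₁ (T.m _ _) ⨾ ((T.m _ _ ⨾ (T.F₁ X.action ⊕₁ T.F₁ Y.action)) ⨾ (X.action ⊕₁ Y.action))
          ≈⟨ ⨾-congˡ (trans assoc (⨾-congˡ (sym ⊕-homomorphism))) ⟩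
        T.F₁ (T.m _ _) ⨾ (T.m _ _ ⨾ ((T.F₁ X.action ⨾ X.action) ⊕₁ (T.F₁ Y.action ⨾ Y.action)))
          ≈⟨ ⨾-congˡ (⨾-congˡ (⊕-cong X.action-mult Y.action-mult)) ⟩
        T.F₁ (T.m _ _) ⨾ (T.m _ _ ⨾ ((μ _ ⨾ X.action) ⊕₁ (μ _ ⨾ Y.action)))
          ≈⟨ trans (⨾-congˡ (⨾-congˡ ⊕-homomorphism)) (sym assoc) ⟩
        (T.F₁ (T.m _ _) ⨾ T.m _ _) ⨾ ((μ _ ⊕₁ μ _) ⨾ (X.action ⊕₁ Y.action))
          ≈⟨ sym assoc ⟩
        ((T.F₁ (T.m _ _) ⨾ T.m _ _) ⨾ (μ _ ⊕₁ μ _)) ⨾ (X.action ⊕₁ Y.action)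
          ≈⟨ ⨾-congʳ (preserves-m μ-comonoidal) ⟩
        (μ _ ⨾ T.m _ _) ⨾ (X.action ⊕₁ Y.action)
          ≈⟨ assoc ⟩
        μ _ ⨾ (T.m _ _ ⨾ (X.action ⊕₁ Y.action)) ∎
    }
    where
    module X = Algebra X
    module Y = Algebra Y

module _ (M : SymmetricMonoidalCategory o ℓ e) where
  open SymmetricMonoidalCategory M

  record IsCommutativeMonoid (A : Obj) (w : ⊥ ⇒ A) (c : A ⊕ A ⇒ A) : Set e where
    field
      c-identityˡ   : (w ⊕₁ id) ⨾ c ≈ λ⇒ A
      c-identityʳ   : (id ⊕₁ w) ⨾ c ≈ ρ⇒ A
      c-assoc       : (c ⊕₁ id) ⨾ c ≈ α⇒ A A A ⨾ (id ⊕₁ c) ⨾ c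
      c-commutative : β A A ⨾ c ≈ c

  record IsMonoidMorphism {A B : Obj} (w : ⊥ ⇒ A) (c : A ⊕ A ⇒ A) (w′ : ⊥ ⇒ B) (c′ : B ⊕ B ⇒ B)
                          (f : A ⇒ B) : Set e where
    field
      preserves-w : w ⨾ f ≈ w′
      preserves-c : c ⨾ f ≈ (f ⊕₁ f) ⨾ c′

  constantData : ComonoidalData M M
  constantData = record { functor = constFunctor U U ⊥ ; m⊥ = id ; m = λ _ _ → ρ⇐ ⊥ }

  doubleData : ComonoidalData M M → ComonoidalData M M
  doubleData F = record
    { functor = record
        { F₀ = λ A → F.F₀ A ⊕ F.F₀ A
        ; F₁ = λ f → F.F₁ f ⊕₁ F.F₁ f
        ; F-cong = λ p → ⊕-cong (F.F-cong p) (F.F-cong p)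
        ; identity = Equiv.trans (⊕-cong F.identity F.identity) ⊕-identity
        ; homomorphism =
            Equiv.trans (⊕-cong F.homomorphism F.homomorphism) ⊕-homomorphism
        }
    ; m⊥ = (F.m⊥ ⊕₁ F.m⊥) ⨾ λ⇒ ⊥
    ; m = λ A B → (F.m A B ⊕₁ F.m A B) ⨾ interchange (F.F₀ A) (F.F₀ B) (F.F₀ A) (F.F₀ B)
    }
    where module F = ComonoidalData F

record DualLinearCategory (o ℓ e : Level) : Set (suc (o ⊔ ℓ ⊔ e)) where
  field
    𝓛 : SymmetricMonoidalCoclosedCategory o ℓ e

  open SymmetricMonoidalCoclosedCategory 𝓛 public
  open SymmetricMonoidalCategory symmetricMonoidalCategory

  field
    ?-monad : SymmetricComonoidalMonad symmetricMonoidalCategory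

  module whyNot = SymmetricComonoidalMonad ?-monad
  module T = whyNot.T

  ?₀ : Obj → Obj
  ?₀ = T.F₀

  field
    weakening   : NaturalTransformation
                    (ComonoidalData.functor (constantData symmetricMonoidalCategory))
                    T.functor
    contraction : NaturalTransformation
                    (ComonoidalData.functor
                      (doubleData symmetricMonoidalCategory T.comonoidalData))
                    T.functor

  w : ∀ A → ⊥ ⇒ ?₀ A
  w = NaturalTransformation.η weakening

  c : ∀ A → ?₀ A ⊕ ?₀ A ⇒ ?₀ A
  c = NaturalTransformation.η contraction

  field
    w-comonoidal : IsComonoidalTransformation
                     (constantData symmetricMonoidalCategory)
                     T.comonoidalData
                     weakening
    c-comonoidal : IsComonoidalTransformation
                     (doubleData symmetricMonoidalCategory T.comonoidalData)
                     T.comonoidalData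
                     contraction

    isCommutativeMonoid : ∀ A → IsCommutativeMonoid symmetricMonoidalCategory
                                  (?₀ A) (w A) (c A)

    w-algebraMorphism : ∀ A → IsAlgebraMorphism ?-monad
                                (⊥-algebra ?-monad)
                                (freeAlgebra ?-monad A)
                                (w A)
    c-algebraMorphism : ∀ A → IsAlgebraMorphism ?-monad
                                (⊕-algebra ?-monad (freeAlgebra ?-monad A) (freeAlgebra ?-monad A))
                                (freeAlgebra ?-monad A)
                                (c A)

    algebraMorphism⇒monoidMorphism :
      ∀ {A B} (f : ?₀ A ⇒ ?₀ B) →
      IsAlgebraMorphism ?-monad (freeAlgebra ?-monad A) (freeAlgebra ?-monad B) f →
      IsMonoidMorphism symmetricMonoidalCategory (w A) (c A) (w B) (c B) f

record DualLNLModel (o ℓ e o′ ℓ′ e′ : Level) : Set (suc (o ⊔ ℓ ⊔ e ⊔ o′ ⊔ ℓ′ ⊔ e′)) where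
  field
    𝓛 : SymmetricMonoidalCoclosedCategory o ℓ e
    𝓒 : CocartesianCoclosedCategory o′ ℓ′ e′

  module 𝓛 = SymmetricMonoidalCoclosedCategory 𝓛
  module 𝓒 = CocartesianCoclosedCategory 𝓒

  field
    H⊣J : SymmetricComonoidalAdjunction
            𝓛.symmetricMonoidalCategory
            𝓒.symmetricMonoidalCategory

{-# OPTIONS --safe #-}

-- Every ?-algebra X carries a monoid structure for which all algebra morphisms
-- are monoid morphisms, so the tensor product of algebras is their coproduct
-- and ⊥ is initial.  𝓒 is the full subcategory of ?-algebras on the finite
-- sums of free algebras.  It is coclosed because
--   Hom(?B, Y ⊕ X) ≅ Hom(B, Y ⊕ X) ≅ Hom(B •– X, Y) ≅ Hom(?(B •– X), Y),
-- so that ?B − X is ?(B •– X), and because − ⊕ X has a universal arrow from a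
-- sum as soon as it has one from each summand.  H and J are the free and
-- forgetful functors; J is strict since the coherence maps of the coproduct
-- are those of the tensor product.

module Submission where

open import Level using (Level; _⊔_)
open import Data.Product using (Σ-syntax; _,_)
open import Relation.Binary.PropositionalEquality using (_≡_)
import Relation.Binary.PropositionalEquality as ≡
open import Defs

private
  variable
    o ℓ e o′ ℓ′ e′ o″ ℓ″ e″ : Level

-- Equational reasoning in a category.

module CategoryLemmas (C : Category o ℓ e) where
  open Category C
  open Equiv

  private
    variable
      A A′ B B′ X Y : Obj
      f g h k : A ⇒ B

  infixr 4 _∙_
  _∙_ : f ≈ g → g ≈ h → f ≈ h
  _∙_ = trans

  pullʳ : g ⨾ h ≈ k → f ⨾ g ⨾ h ≈ f ⨾ k
  pullʳ p = assoc ∙ ⨾-congˡ p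

  paste : {a : A ⇒ B} {b : A′ ⇒ B′} {c : X ⇒ Y}
          {f : B ⇒ B′} {f′ : A ⇒ A′} {g : B′ ⇒ Y} {g′ : A′ ⇒ X} →
          a ⨾ f ≈ f′ ⨾ b → b ⨾ g ≈ g′ ⨾ c → a ⨾ (f ⨾ g) ≈ f′ ⨾ g′ ⨾ c
  paste p q = sym assoc ∙ ⨾-congʳ p ∙ pullʳ q ∙ sym assoc

  cancelʳ : g ⨾ h ≈ id → f ⨾ g ⨾ h ≈ f
  cancelʳ p = pullʳ p ∙ identityʳ

  cancelˡ : f ⨾ g ≈ id → f ⨾ (g ⨾ h) ≈ h
  cancelˡ p = sym assoc ∙ ⨾-congʳ p ∙ identityˡ

  splitEpi-cancel : {r : A ⇒ B} {s : B ⇒ A} → s ⨾ r ≈ id → r ⨾ f ≈ r ⨾ g → f ≈ g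
  splitEpi-cancel p q = sym (cancelˡ p) ∙ ⨾-congˡ q ∙ cancelˡ p

  splitMono-cancel : {s : A ⇒ B} {r : B ⇒ A} → s ⨾ r ≈ id → f ⨾ s ≈ g ⨾ s → f ≈ g
  splitMono-cancel p q = sym (cancelʳ p) ∙ ⨾-congʳ q ∙ cancelʳ p

  -- Used to pass from naturality of an isomorphism to naturality of its inverse: after
  -- precomposition with `_≅_.from i` both sides reduce to `f`.
  ≅-swap : (i : A ≅ B) (j : A′ ≅ B′) →
           f ⨾ _≅_.from j ≈ _≅_.from i ⨾ g → g ⨾ _≅_.to j ≈ _≅_.to i ⨾ f
  ≅-swap i j p = splitEpi-cancel (_≅_.isoʳ i)
    (sym assoc ∙ ⨾-congʳ (sym p) ∙ cancelʳ (_≅_.isoˡ j) ∙ sym (cancelˡ (_≅_.isoˡ i)))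

module CoproductLemmas {C : Category o ℓ e} (cocartesian : Cocartesian C) where
  open Category C
  open Cocartesian cocartesian
  open CategoryLemmas C
  open Equiv

  injections-jointlyEpic : ∀ {A B X} {g h : A + B ⇒ X} → i₁ ⨾ g ≈ i₁ ⨾ h → i₂ ⨾ g ≈ i₂ ⨾ h → g ≈ h
  injections-jointlyEpic p q = sym (unique p q) ∙ unique refl refl

-- Universal arrows and left adjoints.

module _ {C : Category o ℓ e} {D : Category o′ ℓ′ e′} where
  private
    module C = Category C
    module D = Category D
    module CL = CategoryLemmas C
    module DL = CategoryLemmas D
  open CL using (_∙_)
  open C.Equiv using (refl; sym)

  -- The value of a left adjoint at one object, so that adjoints can be assembled object by object.
  -- Stating `unique` as joint cancellation makes congruence and functoriality of `lift` derivable.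
  record UniversalArrow (R : Functor D C) (X : C.Obj) : Set (o′ ⊔ ℓ ⊔ ℓ′ ⊔ e ⊔ e′) where
    private
      module R = Functor R
    field
      obj      : D.Obj
      unit     : X C.⇒ R.F₀ obj
      lift     : ∀ {Y} → X C.⇒ R.F₀ Y → obj D.⇒ Y
      commutes : ∀ {Y} {f : X C.⇒ R.F₀ Y} → unit C.⨾ R.F₁ (lift f) C.≈ f
      unique   : ∀ {Y} {g h : obj D.⇒ Y} → unit C.⨾ R.F₁ g C.≈ unit C.⨾ R.F₁ h → g D.≈ h

    unit-⨾ : ∀ {Y Z} {g : obj D.⇒ Y} {h : Y D.⇒ Z} {k : X C.⇒ R.F₀ Y} →
             unit C.⨾ R.F₁ g C.≈ k → unit C.⨾ R.F₁ (g D.⨾ h) C.≈ k C.⨾ R.F₁ h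
    unit-⨾ p = C.⨾-congˡ R.homomorphism ∙ sym C.assoc ∙ C.⨾-congʳ p

  adjunction⇒universal : {L : Functor C D} {R : Functor D C} → L ⊣ R → ∀ X → UniversalArrow R X
  adjunction⇒universal {L} {R} L⊣R X = record
    { obj = L.F₀ X
    ; unit = unit.η X
    ; lift = λ f → L.F₁ f D.⨾ counit.η _
    ; commutes = C.⨾-congˡ R.homomorphism ∙ sym C.assoc ∙ C.⨾-congʳ (sym (unit.natural _))
                 ∙ CL.cancelʳ zag
    ; unique = λ p → D.Equiv.sym transpose DL.∙ D.⨾-congʳ (L.F-cong p) DL.∙ transpose
    }
    where
    open _⊣_ L⊣R
    module L = Functor L
    module R = Functor R

    transpose : ∀ {Y} {g : L.F₀ X D.⇒ Y} → L.F₁ (unit.η X C.⨾ R.F₁ g) D.⨾ counit.η Y D.≈ g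
    transpose = D.⨾-congʳ L.homomorphism DL.∙ DL.pullʳ (counit.natural _)
                DL.∙ D.Equiv.sym D.assoc DL.∙ D.⨾-congʳ zig DL.∙ D.identityˡ

  module _ {R : Functor D C} (u : ∀ X → UniversalArrow R X) where
    private
      module R = Functor R
      module u X = UniversalArrow (u X)

    leftAdjoint : Functor C D
    leftAdjoint = record
      { F₀ = u.obj
      ; F₁ = λ {X} {Y} f → u.lift X (f C.⨾ u.unit Y)
      ; F-cong = λ {X} p → u.unique X (u.commutes X ∙ C.⨾-congʳ p ∙ sym (u.commutes X))
      ; identity = λ {X} → u.unique X
          (u.commutes X ∙ C.identityˡ ∙ sym C.identityʳ ∙ C.⨾-congˡ (sym R.identity))
      ; homomorphism = λ {X} {Y} {Z} → u.unique X
          (u.commutes X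
           ∙ sym (u.unit-⨾ X (u.commutes X) ∙ CL.pullʳ (u.commutes Y) ∙ sym C.assoc))
      }

    leftAdjoint-⊣ : leftAdjoint ⊣ R
    leftAdjoint-⊣ = record
      { unit = record { η = u.unit ; natural = λ {X} f → sym (u.commutes X) }
      ; counit = record
          { η = λ B → u.lift (R.F₀ B) C.id
          ; natural = λ {A} {B} g → u.unique (R.F₀ A)
              (u.unit-⨾ _ (u.commutes _) ∙ CL.cancelʳ (u.commutes _)
               ∙ sym (u.unit-⨾ _ (u.commutes _) ∙ C.identityˡ))
          }
      ; zig = λ {X} → u.unique X
          (u.unit-⨾ X (u.commutes X) ∙ CL.cancelʳ (u.commutes _)
           ∙ sym (C.⨾-congˡ R.identity ∙ C.identityʳ))
      ; zag = λ {B} → u.commutes (R.F₀ B)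
      }

  module _ {R : Functor D C} (cC : Cocartesian C) (cD : Cocartesian D) where
    private
      module R = Functor R
      module C+ = Cocartesian cC
      module D+ = Cocartesian cD
      open CoproductLemmas cC
      open CoproductLemmas cD renaming (injections-jointlyEpic to injections-jointlyEpicᴰ)

    universal-𝟎 : UniversalArrow R C+.𝟎
    universal-𝟎 = record
      { obj = D+.𝟎
      ; unit = C+.¡
      ; lift = λ _ → D+.¡
      ; commutes = sym (C+.¡-unique _) ∙ C+.¡-unique _
      ; unique = λ _ → D.Equiv.sym (D+.¡-unique _) DL.∙ D+.¡-unique _
      }

    -- A map from `X + Y` to `R Z` is a pair of maps from `X` and `Y`, hence a pair of maps from the
    -- two representing objects to `Z`, hence one map from their coproduct.
    universal-+ : ∀ {X Y} → UniversalArrow R X → UniversalArrow R Y → UniversalArrow R (X C+.+ Y)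
    universal-+ uX uY = record
      { obj = uX.obj D+.+ uY.obj
      ; unit = unit
      ; lift = λ f → D+.[ uX.lift (C+.i₁ C.⨾ f) , uY.lift (C+.i₂ C.⨾ f) ]
      ; commutes = injections-jointlyEpic
          (at₁ ∙ C.⨾-congˡ (R.F-cong D+.inject₁) ∙ uX.commutes)
          (at₂ ∙ C.⨾-congˡ (R.F-cong D+.inject₂) ∙ uY.commutes)
      ; unique = λ p → injections-jointlyEpicᴰ
          (uX.unique (sym at₁ ∙ C.⨾-congˡ p ∙ at₁))
          (uY.unique (sym at₂ ∙ C.⨾-congˡ p ∙ at₂))
      }
      where
      module uX = UniversalArrow uX
      module uY = UniversalArrow uY
      unit = C+.[ uX.unit C.⨾ R.F₁ D+.i₁ , uY.unit C.⨾ R.F₁ D+.i₂ ]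

      at₁ : ∀ {Z} {g : uX.obj D+.+ uY.obj D.⇒ Z} →
            C+.i₁ C.⨾ (unit C.⨾ R.F₁ g) C.≈ uX.unit C.⨾ R.F₁ (D+.i₁ D.⨾ g)
      at₁ = sym C.assoc ∙ C.⨾-congʳ C+.inject₁ ∙ sym (uX.unit-⨾ refl)

      at₂ : ∀ {Z} {g : uX.obj D+.+ uY.obj D.⇒ Z} →
            C+.i₂ C.⨾ (unit C.⨾ R.F₁ g) C.≈ uY.unit C.⨾ R.F₁ (D+.i₂ D.⨾ g)
      at₂ = sym C.assoc ∙ C.⨾-congʳ C+.inject₂ ∙ sym (uY.unit-⨾ refl)

module _ {C : Category o ℓ e} {D : Category o′ ℓ′ e′} {E : Category o″ ℓ″ e″}
         {J : Functor D C} {R : Functor E D} where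
  private
    module C = Category C
    module D = Category D
    module J = Functor J
    module R = Functor R
  open CategoryLemmas C
  open C.Equiv using (refl; sym)

  universal-⨾ : ∀ {X} (u : UniversalArrow J X) → UniversalArrow R (UniversalArrow.obj u) →
                UniversalArrow (R ⨾F J) X
  universal-⨾ u v = record
    { obj = v.obj
    ; unit = u.unit C.⨾ J.F₁ v.unit
    ; lift = λ f → v.lift (u.lift f)
    ; commutes = sym (u.unit-⨾ refl) ∙ C.⨾-congˡ (J.F-cong v.commutes) ∙ u.commutes
    ; unique = λ p → v.unique (u.unique (u.unit-⨾ refl ∙ p ∙ sym (u.unit-⨾ refl)))
    }
    where
    module u = UniversalArrow u
    module v = UniversalArrow v

  -- Maps from `u.obj` to `R Y` correspond along `u` to maps from `X` to `J (R Y)`, which `v.obj`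
  -- already represents.
  universal-descend : ∀ {X} (u : UniversalArrow J X) → UniversalArrow (R ⨾F J) X →
                      UniversalArrow R (UniversalArrow.obj u)
  universal-descend u v = record
    { obj = v.obj
    ; unit = u.lift v.unit
    ; lift = λ f → v.lift (u.unit C.⨾ J.F₁ f)
    ; commutes = u.unique (u.unit-⨾ u.commutes ∙ v.commutes)
    ; unique = λ p → v.unique
        (sym (u.unit-⨾ u.commutes) ∙ C.⨾-congˡ (J.F-cong p) ∙ u.unit-⨾ u.commutes)
    }
    where
    module u = UniversalArrow u
    module v = UniversalArrow v

-- Coherence in a symmetric monoidal category.

module MonoidalLemmas (M : SymmetricMonoidalCategory o ℓ e) where
  open SymmetricMonoidalCategory M
  open CategoryLemmas U
  open Equiv

  private
    variable
      A A′ B B′ X X′ Y Y′ : Obj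
      f g h : A ⇒ B

  ⊕-congˡ : f ≈ g → h ⊕₁ f ≈ h ⊕₁ g
  ⊕-congˡ p = ⊕-cong refl p

  ⊕-congʳ : f ≈ g → f ⊕₁ h ≈ g ⊕₁ h
  ⊕-congʳ p = ⊕-cong p refl

  ⊕-merge : {f : A ⇒ B} {g : B ⇒ X} {h : A ⇒ X} {f′ : A′ ⇒ B′} {g′ : B′ ⇒ X′} {h′ : A′ ⇒ X′} →
            f ⨾ g ≈ h → f′ ⨾ g′ ≈ h′ → (f ⊕₁ f′) ⨾ (g ⊕₁ g′) ≈ h ⊕₁ h′
  ⊕-merge p q = sym ⊕-homomorphism ∙ ⊕-cong p q

  ⊕-split : {f : A ⇒ B} {g : B ⇒ X} {h : A ⇒ X} {f′ : A′ ⇒ B′} {g′ : B′ ⇒ X′} {h′ : A′ ⇒ X′} →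
            h ≈ f ⨾ g → h′ ≈ f′ ⨾ g′ → h ⊕₁ h′ ≈ (f ⊕₁ f′) ⨾ (g ⊕₁ g′)
  ⊕-split p q = ⊕-cong p q ∙ ⊕-homomorphism

  -- The natural isomorphism `ρ⇒` identifies tensoring with `⊥` with the identity functor.
  ⊕⊥-faithful : {f g : A ⇒ B} → f ⊕₁ id {⊥} ≈ g ⊕₁ id → f ≈ g
  ⊕⊥-faithful p = splitEpi-cancel (_≅_.isoʳ (unitorʳ _))
    (sym (ρ-natural _) ∙ ⨾-congʳ p ∙ ρ-natural _)

  -- Kelly's argument: it suffices to prove the equation tensored with ⊥, where
  -- it follows from the pentagon and the triangle.
  α-ρ : α⇒ A B ⊥ ⨾ (id ⊕₁ ρ⇒ B) ≈ ρ⇒ (A ⊕ B)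
  α-ρ = ⊕⊥-faithful (splitMono-cancel (_≅_.isoˡ (associator _ _ _)) (lhs ∙ sym rhs))
    where
    lhs = ⨾-congʳ (⊕-split refl (sym identityˡ)) ∙ pullʳ (α-natural _ _ _)
          ∙ ⨾-congˡ (⨾-congˡ (⊕-split (sym identityˡ) (sym triangle)) ∙ sym assoc) ∙ sym assoc
          ∙ ⨾-congʳ (sym assoc ∙ pentagon)
    rhs = ⨾-congʳ (sym triangle) ∙ pullʳ (⨾-congʳ (⊕-congʳ (sym ⊕-identity)) ∙ α-natural _ _ _)
          ∙ sym assoc

  β-ρ : β ⊥ A ⨾ ρ⇒ A ≈ λ⇒ A
  β-ρ = ⨾-congˡ (sym β-unit) ∙ cancelˡ β-inverse

  β⊥⊥≈id : β ⊥ ⊥ ≈ id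
  β⊥⊥≈id = splitMono-cancel (_≅_.isoˡ (unitorˡ _)) (β-unit ∙ sym λ⊥≈ρ⊥ ∙ sym identityˡ)

  α⇐-natural : (f : A ⇒ A′) (g : B ⇒ B′) (h : X ⇒ X′) →
               (f ⊕₁ (g ⊕₁ h)) ⨾ α⇐ A′ B′ X′ ≈ α⇐ A B X ⨾ ((f ⊕₁ g) ⊕₁ h)
  α⇐-natural f g h = ≅-swap (associator _ _ _) (associator _ _ _) (α-natural f g h)

  λ⇐-natural : (f : A ⇒ B) → f ⨾ λ⇐ B ≈ λ⇐ A ⨾ (id ⊕₁ f)
  λ⇐-natural f = ≅-swap (unitorˡ _) (unitorˡ _) (λ-natural f)

  ρ⇐-natural : (f : A ⇒ B) → f ⨾ ρ⇐ B ≈ ρ⇐ A ⨾ (f ⊕₁ id)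
  ρ⇐-natural f = ≅-swap (unitorʳ _) (unitorʳ _) (ρ-natural f)

  interchange-natural : (f : A ⇒ A′) (g : B ⇒ B′) (h : X ⇒ X′) (k : Y ⇒ Y′) →
    ((f ⊕₁ g) ⊕₁ (h ⊕₁ k)) ⨾ interchange A′ B′ X′ Y′
      ≈ interchange A B X Y ⨾ ((f ⊕₁ h) ⊕₁ (g ⊕₁ k))
  interchange-natural f g h k =
    paste (paste (α-natural f g (h ⊕₁ k))
                 (⊕-merge (identityʳ ∙ sym identityˡ) swapMiddle ∙ ⊕-homomorphism))
          (α⇐-natural f h (g ⊕₁ k))
    where
    swapMiddle = paste (paste (α⇐-natural g h k)
                              (⊕-merge (β-natural g h) (identityʳ ∙ sym identityˡ) ∙ ⊕-homomorphism))
                       (α-natural h g k)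

  -- The two middle factors are swapped by `β ⊥ ⊥`, which is the identity, so the associators
  -- cancel.
  interchange-⊥⊥ : interchange A ⊥ ⊥ B ≈ id
  interchange-⊥⊥ =
    ⨾-congʳ (⨾-congˡ (⊕-congˡ (⨾-congʳ (⨾-congˡ (⊕-congʳ β⊥⊥≈id ∙ ⊕-identity) ∙ identityʳ)
                               ∙ _≅_.isoʳ (associator _ _ _)) ∙ ⊕-identity) ∙ identityʳ)
    ∙ _≅_.isoˡ (associator _ _ _)

-- Algebras of the monad and their tensor product.

module AlgebraSums (D : DualLinearCategory o ℓ e) where
  open DualLinearCategory D
  open SymmetricMonoidalCategory symmetricMonoidalCategory
  open CategoryLemmas U
  open MonoidalLemmas symmetricMonoidalCategory
  open Equiv
  open whyNot using (η; η-natural; μ; μ-natural; μ-assoc; μ-identityˡ; μ-identityʳ;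
                     η-comonoidal; μ-comonoidal)
  open IsComonoidalTransformation
  open IsAlgebraMorphism

  Alg : Set (o ⊔ ℓ ⊔ e)
  Alg = Algebra ?-monad

  free : Obj → Alg
  free = freeAlgebra ?-monad

  ⊥ᴬ : Alg
  ⊥ᴬ = ⊥-algebra ?-monad

  infixr 10 _⊕ᴬ_
  _⊕ᴬ_ : Alg → Alg → Alg
  _⊕ᴬ_ = ⊕-algebra ?-monad

  Mor : (X Y : Alg) → Algebra.carrier X ⇒ Algebra.carrier Y → Set e
  Mor = IsAlgebraMorphism ?-monad

  ⟨_⟩ : Alg → Obj
  ⟨ X ⟩ = Algebra.carrier X

  act : (X : Alg) → ?₀ ⟨ X ⟩ ⇒ ⟨ X ⟩
  act X = Algebra.action X

  private
    variable
      X Y Z X′ Y′ : Alg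

  Mor-id : Mor X X id
  Mor-id .commutes = ⨾-congʳ T.identity ∙ identityˡ ∙ sym identityʳ

  Mor-⨾ : {f : ⟨ X ⟩ ⇒ ⟨ Y ⟩} {g : ⟨ Y ⟩ ⇒ ⟨ Z ⟩} → Mor X Y f → Mor Y Z g → Mor X Z (f ⨾ g)
  Mor-⨾ p q .commutes =
    ⨾-congʳ T.homomorphism ∙ pullʳ (q .commutes) ∙ sym assoc ∙ ⨾-congʳ (p .commutes) ∙ assoc

  Mor-⁻¹ : (i : ⟨ X ⟩ ≅ ⟨ Y ⟩) → Mor X Y (_≅_.from i) → Mor Y X (_≅_.to i)
  Mor-⁻¹ i p .commutes = splitEpi-cancel
    (sym T.homomorphism ∙ T.F-cong (_≅_.isoʳ i) ∙ T.identity)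
    (sym assoc ∙ ⨾-congʳ (sym T.homomorphism ∙ T.F-cong (_≅_.isoˡ i) ∙ T.identity) ∙ identityˡ
     ∙ sym (sym assoc ∙ ⨾-congʳ (p .commutes) ∙ cancelʳ (_≅_.isoˡ i)))

  Mor-⊕₁ : {f : ⟨ X ⟩ ⇒ ⟨ X′ ⟩} {g : ⟨ Y ⟩ ⇒ ⟨ Y′ ⟩} →
           Mor X X′ f → Mor Y Y′ g → Mor (X ⊕ᴬ Y) (X′ ⊕ᴬ Y′) (f ⊕₁ g)
  Mor-⊕₁ p q .commutes = paste (T.m-natural _ _)
    (⊕-merge (p .commutes) (q .commutes) ∙ ⊕-homomorphism)

  Mor-act : (X : Alg) → Mor (free ⟨ X ⟩) X (act X)
  Mor-act X .commutes = Algebra.action-mult X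

  Mor-μ : ∀ A → Mor (free (?₀ A)) (free A) (μ A)
  Mor-μ A .commutes = μ-assoc

  Mor-? : ∀ {A B} (f : A ⇒ B) → Mor (free A) (free B) (T.F₁ f)
  Mor-? f .commutes = μ-natural f

  -- Here and for `λ⇒`, `α⇒` and `β` below, the matching coherence law of the comonoidal functor
  -- `T`, followed by the actions, is the required square.
  Mor-ρ : Mor (X ⊕ᴬ ⊥ᴬ) X (ρ⇒ ⟨ X ⟩)
  Mor-ρ .commutes = sym
    (⨾-congʳ (⨾-congˡ (⊕-split (sym identityˡ) (sym identityʳ)) ∙ sym assoc) ∙ pullʳ (ρ-natural _)
     ∙ sym assoc ∙ ⨾-congʳ (⨾-congʳ T.m-unitʳ ∙ cancelʳ (_≅_.isoʳ (unitorʳ _))))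

  Mor-λ : Mor (⊥ᴬ ⊕ᴬ X) X (λ⇒ ⟨ X ⟩)
  Mor-λ .commutes = sym
    (⨾-congʳ (⨾-congˡ (⊕-split (sym identityʳ) (sym identityˡ)) ∙ sym assoc) ∙ pullʳ (λ-natural _)
     ∙ sym assoc ∙ ⨾-congʳ (⨾-congʳ T.m-unitˡ ∙ cancelʳ (_≅_.isoʳ (unitorˡ _))))

  Mor-α : Mor ((X ⊕ᴬ Y) ⊕ᴬ Z) (X ⊕ᴬ (Y ⊕ᴬ Z)) (α⇒ ⟨ X ⟩ ⟨ Y ⟩ ⟨ Z ⟩)
  Mor-α .commutes = sym
    (⨾-congʳ (⨾-congˡ (⊕-split refl (sym identityˡ)) ∙ sym assoc) ∙ pullʳ (α-natural _ _ _)
     ∙ sym assoc ∙ ⨾-congʳ T.m-assoc ∙ pullʳ (⊕-merge identityˡ refl) ∙ assoc)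

  Mor-β : Mor (X ⊕ᴬ Y) (Y ⊕ᴬ X) (β ⟨ X ⟩ ⟨ Y ⟩)
  Mor-β .commutes = sym (pullʳ (β-natural _ _) ∙ sym assoc ∙ ⨾-congʳ T.m-sym ∙ assoc)

  -- Every algebra X is a retract of the free algebra ?X, from which it inherits
  -- a monoid structure.

  zeroᴬ : (X : Alg) → ⊥ ⇒ ⟨ X ⟩
  zeroᴬ X = w ⟨ X ⟩ ⨾ act X

  plusᴬ : (X : Alg) → ⟨ X ⟩ ⊕ ⟨ X ⟩ ⇒ ⟨ X ⟩
  plusᴬ X = (η ⟨ X ⟩ ⊕₁ η ⟨ X ⟩) ⨾ c ⟨ X ⟩ ⨾ act X

  w-natural : ∀ {A B} (f : A ⇒ B) → w A ⨾ T.F₁ f ≈ w B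
  w-natural f = sym (NaturalTransformation.natural weakening f) ∙ identityˡ

  c-natural : ∀ {A B} (f : A ⇒ B) → c A ⨾ T.F₁ f ≈ (T.F₁ f ⊕₁ T.F₁ f) ⨾ c B
  c-natural f = sym (NaturalTransformation.natural contraction f)

  -- The algebra square moves `f` under `T`, where naturality of `w` absorbs it. `Mor-plus` does the
  -- same with `c` and `η`, and so works for arbitrary algebras.
  Mor-zero : {f : ⟨ X ⟩ ⇒ ⟨ Y ⟩} → Mor X Y f → zeroᴬ X ⨾ f ≈ zeroᴬ Y
  Mor-zero p = pullʳ (sym (p .commutes)) ∙ sym assoc ∙ ⨾-congʳ (w-natural _)

  Mor-plus : {f : ⟨ X ⟩ ⇒ ⟨ Y ⟩} → Mor X Y f → plusᴬ X ⨾ f ≈ (f ⊕₁ f) ⨾ plusᴬ Y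
  Mor-plus p = pullʳ (sym (p .commutes)) ∙ sym assoc
    ∙ ⨾-congʳ (pullʳ (c-natural _) ∙ sym assoc
               ∙ ⨾-congʳ (⊕-merge (sym (η-natural _)) (sym (η-natural _)) ∙ ⊕-homomorphism) ∙ assoc)
    ∙ assoc

  -- Condition (b) enters here: `μ A` is a morphism of free algebras. By `plus-free`, the inherited
  -- addition on a free algebra is then the given `c`.
  c-μ : ∀ {A} → c (?₀ A) ⨾ μ A ≈ (μ A ⊕₁ μ A) ⨾ c A
  c-μ {A} = IsMonoidMorphism.preserves-c (algebraMorphism⇒monoidMorphism (μ A) (Mor-μ A))

  plus-free : ∀ {A} → plusᴬ (free A) ≈ c A
  plus-free = pullʳ c-μ ∙ sym assoc
    ∙ ⨾-congʳ (⊕-merge μ-identityˡ μ-identityˡ ∙ ⊕-identity) ∙ identityˡ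

  c-act : c ⟨ X ⟩ ⨾ act X ≈ (act X ⊕₁ act X) ⨾ plusᴬ X
  c-act {X} = ⨾-congʳ (sym plus-free) ∙ Mor-plus (Mor-act X)

  -- Writing `id` as `η` followed by the action lifts the equation along `c-act` to the free
  -- algebra, where it is a unit law of the monoid `w`, `c`.
  plus-identityˡ : (zeroᴬ X ⊕₁ id) ⨾ plusᴬ X ≈ λ⇒ ⟨ X ⟩
  plus-identityˡ {X} =
    ⨾-congʳ (⊕-split refl (sym (Algebra.action-unit X)))
    ∙ pullʳ (sym (c-act {X})) ∙ ⨾-congʳ (⊕-split (sym identityˡ) (sym identityʳ)) ∙ sym assoc
    ∙ ⨾-congʳ (pullʳ (IsCommutativeMonoid.c-identityˡ (isCommutativeMonoid _)) ∙ λ-natural _)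
    ∙ cancelʳ (Algebra.action-unit X)

  plus-identityʳ : (id ⊕₁ zeroᴬ X) ⨾ plusᴬ X ≈ ρ⇒ ⟨ X ⟩
  plus-identityʳ {X} =
    ⨾-congʳ (⊕-split (sym (Algebra.action-unit X)) refl)
    ∙ pullʳ (sym (c-act {X})) ∙ ⨾-congʳ (⊕-split (sym identityʳ) (sym identityˡ)) ∙ sym assoc
    ∙ ⨾-congʳ (pullʳ (IsCommutativeMonoid.c-identityʳ (isCommutativeMonoid _)) ∙ ρ-natural _)
    ∙ cancelʳ (Algebra.action-unit X)

  zero-Mor : Mor ⊥ᴬ X (zeroᴬ X)
  zero-Mor {X} = Mor-⨾ (w-algebraMorphism ⟨ X ⟩) (Mor-act X)

  -- The factor `η` of `plusᴬ` need not be an algebra morphism, so composition does not suffice.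
  -- Instead the algebra square of `c` brings in `μ`, against which `T.F₁ (η _)` cancels.
  plus-Mor : Mor (X ⊕ᴬ X) X (plusᴬ X)
  plus-Mor {X} .commutes =
    ⨾-congʳ T.homomorphism ∙ pullʳ (Algebra.action-mult X) ∙ ⨾-congʳ T.homomorphism ∙ sym assoc
    ∙ ⨾-congʳ (pullʳ (c-algebraMorphism ⟨ X ⟩ .commutes) ∙ sym assoc
               ∙ ⨾-congʳ (sym assoc ∙ ⨾-congʳ (T.m-natural _ _)
                          ∙ cancelʳ (⊕-merge μ-identityʳ μ-identityʳ ∙ ⊕-identity)))
    ∙ pullʳ (c-act {X}) ∙ sym assoc

  -- The action of `⊥ᴬ` is `T.m⊥`, so this is the unit law of the comonoidal transformation `w`; its
  -- binary law gives `zero-⊕`.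
  zero-⊥ : zeroᴬ ⊥ᴬ ≈ id
  zero-⊥ = preserves-m⊥ w-comonoidal

  zero-⊕ : zeroᴬ (X ⊕ᴬ Y) ≈ ρ⇐ ⊥ ⨾ (zeroᴬ X ⊕₁ zeroᴬ Y)
  zero-⊕ = sym assoc ∙ ⨾-congʳ (sym (preserves-m w-comonoidal)) ∙ pullʳ (sym ⊕-homomorphism)

  -- Addition on a tensor product is componentwise because `c` and `η` are comonoidal; `interchange`
  -- comes from the comonoidal structure on the source of `c`.
  plus-⊕ : plusᴬ (X ⊕ᴬ Y) ≈ interchange ⟨ X ⟩ ⟨ Y ⟩ ⟨ X ⟩ ⟨ Y ⟩ ⨾ (plusᴬ X ⊕₁ plusᴬ Y)
  plus-⊕ =
    sym assoc ∙ ⨾-congʳ (pullʳ (sym (preserves-m c-comonoidal)) ∙ sym assoc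
      ∙ ⨾-congʳ (sym assoc
        ∙ ⨾-congʳ (⊕-merge (sym (preserves-m η-comonoidal) ∙ identityˡ)
                           (sym (preserves-m η-comonoidal) ∙ identityˡ))
        ∙ interchange-natural _ _ _ _))
    ∙ pullʳ (sym ⊕-homomorphism) ∙ pullʳ (⊕-merge (sym assoc) (sym assoc))

  -- Tensor products as coproducts of algebras.

  inl : (X Y : Alg) → ⟨ X ⟩ ⇒ ⟨ X ⟩ ⊕ ⟨ Y ⟩
  inl X Y = ρ⇐ ⟨ X ⟩ ⨾ (id ⊕₁ zeroᴬ Y)

  inr : (X Y : Alg) → ⟨ Y ⟩ ⇒ ⟨ X ⟩ ⊕ ⟨ Y ⟩
  inr X Y = λ⇐ ⟨ Y ⟩ ⨾ (zeroᴬ X ⊕₁ id)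

  copair : (Z : Alg) {A B : Obj} → A ⇒ ⟨ Z ⟩ → B ⇒ ⟨ Z ⟩ → A ⊕ B ⇒ ⟨ Z ⟩
  copair Z f g = (f ⊕₁ g) ⨾ plusᴬ Z

  inl-Mor : Mor X (X ⊕ᴬ Y) (inl X Y)
  inl-Mor = Mor-⨾ (Mor-⁻¹ (unitorʳ _) Mor-ρ) (Mor-⊕₁ Mor-id zero-Mor)

  inr-Mor : Mor Y (X ⊕ᴬ Y) (inr X Y)
  inr-Mor = Mor-⨾ (Mor-⁻¹ (unitorˡ _) Mor-λ) (Mor-⊕₁ zero-Mor Mor-id)

  copair-Mor : {f : ⟨ X ⟩ ⇒ ⟨ Z ⟩} {g : ⟨ Y ⟩ ⇒ ⟨ Z ⟩} →
               Mor X Z f → Mor Y Z g → Mor (X ⊕ᴬ Y) Z (copair Z f g)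
  copair-Mor p q = Mor-⨾ (Mor-⊕₁ p q) plus-Mor

  -- As a morphism, `g` sends the zero of `Y` to that of `Z`, and adding zero changes nothing.
  inl-copair : {f : ⟨ X ⟩ ⇒ ⟨ Z ⟩} {g : ⟨ Y ⟩ ⇒ ⟨ Z ⟩} → Mor Y Z g → inl X Y ⨾ copair Z f g ≈ f
  inl-copair {Z = Z} q = sym assoc
    ∙ ⨾-congʳ (pullʳ (⊕-merge identityˡ (Mor-zero q) ∙ ⊕-split (sym identityʳ) (sym identityˡ))
               ∙ sym assoc ∙ ⨾-congʳ (sym (ρ⇐-natural _)))
    ∙ pullʳ (plus-identityʳ {Z}) ∙ cancelʳ (_≅_.isoʳ (unitorʳ _))

  inr-copair : {f : ⟨ X ⟩ ⇒ ⟨ Z ⟩} {g : ⟨ Y ⟩ ⇒ ⟨ Z ⟩} → Mor X Z f → inr X Y ⨾ copair Z f g ≈ g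
  inr-copair {Z = Z} p = sym assoc
    ∙ ⨾-congʳ (pullʳ (⊕-merge (Mor-zero p) identityˡ ∙ ⊕-split (sym identityˡ) (sym identityʳ))
               ∙ sym assoc ∙ ⨾-congʳ (sym (λ⇐-natural _)))
    ∙ pullʳ (plus-identityˡ {Z}) ∙ cancelʳ (_≅_.isoʳ (unitorˡ _))

  -- In elements, (x,0) + (0,y) = (x+0, 0+y) = (x,y) by componentwise addition. The zeros come from
  -- two adjacent copies of `⊥`, on which `interchange` is trivial.
  copair-inl-inr : copair (X ⊕ᴬ Y) (inl X Y) (inr X Y) ≈ id
  copair-inl-inr {X} {Y} = ⨾-congʳ ⊕-homomorphism ∙ ⨾-congˡ (plus-⊕ {X} {Y}) ∙ sym assoc
    ∙ ⨾-congʳ (pullʳ (interchange-natural _ _ _ _) ∙ ⨾-congˡ (⨾-congʳ interchange-⊥⊥ ∙ identityˡ))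
    ∙ pullʳ (⊕-merge (plus-identityʳ {X}) (plus-identityˡ {Y}))
    ∙ ⊕-merge (_≅_.isoʳ (unitorʳ _)) (_≅_.isoʳ (unitorˡ _)) ∙ ⊕-identity

  -- The identity is the sum of the injections, and the morphism `h` preserves sums.
  copair-unique : {f : ⟨ X ⟩ ⇒ ⟨ Z ⟩} {g : ⟨ Y ⟩ ⇒ ⟨ Z ⟩} {h : ⟨ X ⟩ ⊕ ⟨ Y ⟩ ⇒ ⟨ Z ⟩} →
                  Mor (X ⊕ᴬ Y) Z h → inl X Y ⨾ h ≈ f → inr X Y ⨾ h ≈ g → copair Z f g ≈ h
  copair-unique {X = X} {Y = Y} r p q = ⨾-congʳ (⊕-split (sym p) (sym q)) ∙ pullʳ (sym (Mor-plus r))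
    ∙ sym assoc ∙ ⨾-congʳ (copair-inl-inr {X} {Y}) ∙ identityˡ

  zero-unique : {f : ⊥ ⇒ ⟨ X ⟩} → Mor ⊥ᴬ X f → zeroᴬ X ≈ f
  zero-unique p = sym (Mor-zero p) ∙ ⨾-congʳ zero-⊥ ∙ identityˡ

  -- Coherence maps of the coproduct and of the tensor product.

  copair-⊕₁ : {f : ⟨ X ⟩ ⇒ ⟨ X′ ⟩} {g : ⟨ Y ⟩ ⇒ ⟨ Y′ ⟩} →
              copair (X′ ⊕ᴬ Y′) (f ⨾ inl X′ Y′) (g ⨾ inr X′ Y′) ≈ f ⊕₁ g
  copair-⊕₁ {X′ = X′} {Y′ = Y′} = ⨾-congʳ ⊕-homomorphism ∙ pullʳ (copair-inl-inr {X′} {Y′}) ∙ identityʳ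

  inl-⊥ : inl X ⊥ᴬ ≈ ρ⇐ ⟨ X ⟩
  inl-⊥ = ⨾-congˡ (⊕-congˡ zero-⊥ ∙ ⊕-identity) ∙ identityʳ

  inr-⊥ : inr ⊥ᴬ X ≈ λ⇐ ⟨ X ⟩
  inr-⊥ = ⨾-congˡ (⊕-congʳ zero-⊥ ∙ ⊕-identity) ∙ identityʳ

  -- The left-hand sides of this and the next lemmas are the copairings that
  -- `cocartesian⇒symmetricMonoidal` takes as coherence maps. Uniqueness of copairing reduces each
  -- equation to the injections.
  copair-λ : copair X (zeroᴬ X) id ≈ λ⇒ ⟨ X ⟩
  copair-λ {X} = copair-unique {X = ⊥ᴬ} {Z = X} {Y = X} Mor-λ
    (sym (zero-unique (Mor-⨾ inl-Mor (Mor-λ {X}))))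
    (⨾-congʳ (inr-⊥ {X}) ∙ _≅_.isoʳ (unitorˡ _))

  copair-ρ : copair X id (zeroᴬ X) ≈ ρ⇒ ⟨ X ⟩
  copair-ρ {X} = copair-unique {X = X} {Z = X} {Y = ⊥ᴬ} Mor-ρ
    (⨾-congʳ (inl-⊥ {X}) ∙ _≅_.isoʳ (unitorʳ _))
    (sym (zero-unique (Mor-⨾ inr-Mor (Mor-ρ {X}))))

  copair-β : copair (Y ⊕ᴬ X) (inr Y X) (inl Y X) ≈ β ⟨ X ⟩ ⟨ Y ⟩
  copair-β {Y} {X} = copair-unique {X = X} {Z = Y ⊕ᴬ X} {Y = Y} Mor-β
    (pullʳ (β-natural _ _) ∙ sym assoc
      -- What remains is that `ρ⇐` followed by `β` is `λ⇐`, tested by composing with `λ⇒`.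
      ∙ ⨾-congʳ (splitMono-cancel (_≅_.isoˡ (unitorˡ _))
          (pullʳ β-unit ∙ _≅_.isoʳ (unitorʳ _) ∙ sym (_≅_.isoʳ (unitorˡ _)))))
    (pullʳ (β-natural _ _) ∙ sym assoc
      ∙ ⨾-congʳ (splitMono-cancel (_≅_.isoˡ (unitorʳ _))
          (pullʳ β-ρ ∙ _≅_.isoʳ (unitorˡ _) ∙ sym (_≅_.isoʳ (unitorʳ _)))))

  inl-α : inl (X ⊕ᴬ Y) Z ⨾ α⇒ ⟨ X ⟩ ⟨ Y ⟩ ⟨ Z ⟩ ≈ id ⊕₁ inl Y Z
  inl-α = pullʳ (⨾-congʳ (⊕-congʳ (sym ⊕-identity)) ∙ α-natural _ _ _) ∙ sym assoc
    ∙ ⨾-congʳ (splitMono-cancel (⊕-merge identityˡ (_≅_.isoˡ (unitorʳ _)) ∙ ⊕-identity)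
        (pullʳ α-ρ ∙ _≅_.isoʳ (unitorʳ _)
         ∙ sym (⊕-merge identityˡ (_≅_.isoʳ (unitorʳ _)) ∙ ⊕-identity)))
    ∙ ⊕-merge identityˡ refl

  -- By `zero-⊕` the zero of `X ⊕ᴬ Y` is a pair of zeros. Naturality of `α⇒` moves them outside, and
  -- the triangle turns `ρ⇐` on the left into `λ⇐` on the right.
  inr-α : inr (X ⊕ᴬ Y) Z ⨾ α⇒ ⟨ X ⟩ ⟨ Y ⟩ ⟨ Z ⟩ ≈ inr Y Z ⨾ inr X (Y ⊕ᴬ Z)
  inr-α {X} {Y} {Z} =
    ⨾-congʳ (⨾-congˡ (⊕-split (zero-⊕ {X} {Y}) (sym identityˡ)))
    ∙ pullʳ (pullʳ (α-natural _ _ _) ∙ sym assoc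
        ∙ ⨾-congʳ (splitMono-cancel (⊕-merge identityˡ (_≅_.isoˡ (unitorˡ _)) ∙ ⊕-identity)
            (pullʳ triangle ∙ ⊕-merge (_≅_.isoʳ (unitorʳ _)) identityˡ ∙ ⊕-identity
             ∙ sym (⊕-merge identityˡ (_≅_.isoʳ (unitorˡ _)) ∙ ⊕-identity)))
        ∙ ⊕-merge identityˡ refl ∙ ⊕-split (sym identityˡ) (sym identityʳ))
    ∙ sym assoc ∙ ⨾-congʳ (sym (λ⇐-natural _)) ∙ assoc

  copair-α : copair (X ⊕ᴬ Y ⊕ᴬ Z)
               (copair (X ⊕ᴬ Y ⊕ᴬ Z) (inl X (Y ⊕ᴬ Z)) (inl Y Z ⨾ inr X (Y ⊕ᴬ Z)))
               (inr Y Z ⨾ inr X (Y ⊕ᴬ Z))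
             ≈ α⇒ ⟨ X ⟩ ⟨ Y ⟩ ⟨ Z ⟩
  copair-α {X} {Y} {Z} = copair-unique {X = X ⊕ᴬ Y} {Z = X ⊕ᴬ Y ⊕ᴬ Z} {Y = Z} Mor-α
    (inl-α {X} {Y} {Z} ∙ sym (copair-⊕₁ {X} {X} {Y} {Y ⊕ᴬ Z}) ∙ ⨾-congʳ (⊕-congʳ identityˡ))
    (inr-α {X} {Y} {Z})

  -- The cocartesian category of finite sums of free algebras.

  data FreeSum : Set (o ⊔ ℓ ⊔ e) where
    ∅   : FreeSum
    gen : Obj → FreeSum
    _⊞_ : FreeSum → FreeSum → FreeSum

  ⟦_⟧ : FreeSum → Alg
  ⟦ ∅ ⟧     = ⊥ᴬ
  ⟦ gen A ⟧ = free A
  ⟦ S ⊞ S′ ⟧ = ⟦ S ⟧ ⊕ᴬ ⟦ S′ ⟧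

  ⌊_⌋ : FreeSum → Obj
  ⌊ S ⌋ = ⟨ ⟦ S ⟧ ⟩

  record Hom (S S′ : FreeSum) : Set (ℓ ⊔ e) where
    field
      mor   : ⌊ S ⌋ ⇒ ⌊ S′ ⌋
      isMor : Mor ⟦ S ⟧ ⟦ S′ ⟧ mor
  open Hom

  freeSums : Category (o ⊔ ℓ ⊔ e) (ℓ ⊔ e) e
  freeSums = record
    { Obj = FreeSum
    ; _⇒_ = Hom
    ; _≈_ = λ f g → mor f ≈ mor g
    ; id = record { mor = id ; isMor = Mor-id }
    ; _⨾_ = λ f g → record { mor = mor f ⨾ mor g ; isMor = Mor-⨾ (isMor f) (isMor g) }
    ; equiv = record { refl = refl ; sym = sym ; trans = trans }
    ; ⨾-cong = ⨾-cong
    ; identityˡ = identityˡ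
    ; identityʳ = identityʳ
    ; assoc = assoc
    }

  freeSums-cocartesian : Cocartesian freeSums
  freeSums-cocartesian = record
    { 𝟎 = ∅
    ; ¡ = λ {A} → record { mor = zeroᴬ ⟦ A ⟧ ; isMor = zero-Mor {⟦ A ⟧} }
    ; ¡-unique = λ f → zero-unique (isMor f)
    ; _+_ = _⊞_
    ; i₁ = λ {A} {B} → record
        { mor = inl ⟦ A ⟧ ⟦ B ⟧ ; isMor = inl-Mor {X = ⟦ A ⟧} {Y = ⟦ B ⟧} }
    ; i₂ = λ {A} {B} → record
        { mor = inr ⟦ A ⟧ ⟦ B ⟧ ; isMor = inr-Mor {Y = ⟦ B ⟧} {X = ⟦ A ⟧} }
    ; [_,_] = λ {_} {_} {R} f g → record
        { mor = copair ⟦ R ⟧ (mor f) (mor g) ; isMor = copair-Mor (isMor f) (isMor g) }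
    ; inject₁ = λ {A} {_} {_} {_} {g} → inl-copair {X = ⟦ A ⟧} (isMor g)
    ; inject₂ = λ {_} {B} {_} {f} → inr-copair {Y = ⟦ B ⟧} (isMor f)
    ; unique = λ {A} {B} {R} {_} {_} {h} →
        copair-unique {X = ⟦ A ⟧} {Z = ⟦ R ⟧} {Y = ⟦ B ⟧} (isMor h)
    }

  𝓒 : CocartesianCategory (o ⊔ ℓ ⊔ e) (ℓ ⊔ e) e
  𝓒 = record { U = freeSums ; cocartesian = freeSums-cocartesian }

  𝓒M : SymmetricMonoidalCategory (o ⊔ ℓ ⊔ e) (ℓ ⊔ e) e
  𝓒M = cocartesianMonoidal 𝓒

  private
    module 𝓒M = SymmetricMonoidalCategory 𝓒M

  -- The adjunction between the free and forgetful functors.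

  forget : Functor freeSums U
  forget = record
    { F₀ = ⌊_⌋
    ; F₁ = mor
    ; F-cong = λ p → p
    ; identity = refl
    ; homomorphism = refl
    }

  generate : Functor U freeSums
  generate = record
    { F₀ = gen
    ; F₁ = λ f → record { mor = T.F₁ f ; isMor = Mor-? f }
    ; F-cong = T.F-cong
    ; identity = T.identity
    ; homomorphism = T.homomorphism
    }

  generate⊣forget : generate ⊣ forget
  generate⊣forget = record
    { unit = record { η = η ; natural = η-natural }
    ; counit = record
        { η = λ S → record { mor = act ⟦ S ⟧ ; isMor = Mor-act ⟦ S ⟧ }
        ; natural = λ f → isMor f .commutes
        }
    ; zig = μ-identityʳ
    ; zag = λ {S} → Algebra.action-unit ⟦ S ⟧
    }

  -- The monoidal structure of `𝓒M` seen on underlying maps.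

  mor-⊕₁ : ∀ {S S′ R R′} (f : Hom S S′) (g : Hom R R′) → mor (f 𝓒M.⊕₁ g) ≈ mor f ⊕₁ mor g
  mor-⊕₁ {S} {S′} {R} {R′} f g = copair-⊕₁ {⟦ S ⟧} {⟦ S′ ⟧} {⟦ R ⟧} {⟦ R′ ⟧}

  mor-⊕id : ∀ {S S′} R (f : Hom S S′) → mor (f 𝓒M.⊕₁ 𝓒M.id {R}) ≈ mor f ⊕₁ id
  mor-⊕id R f = mor-⊕₁ f (𝓒M.id {R})

  mor-id⊕ : ∀ {S S′} R (f : Hom S S′) → mor (𝓒M.id {R} 𝓒M.⊕₁ f) ≈ id ⊕₁ mor f
  mor-id⊕ R f = mor-⊕₁ (𝓒M.id {R}) f

  mor-α : ∀ S R Q → mor (𝓒M.α⇒ S R Q) ≈ α⇒ ⌊ S ⌋ ⌊ R ⌋ ⌊ Q ⌋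
  mor-α S R Q = copair-α {⟦ S ⟧} {⟦ R ⟧} {⟦ Q ⟧}

  mor-λ : ∀ S → mor (𝓒M.λ⇒ S) ≈ λ⇒ ⌊ S ⌋
  mor-λ S = copair-λ {⟦ S ⟧}

  mor-λ⇐ : ∀ S → mor (𝓒M.λ⇐ S) ≈ λ⇐ ⌊ S ⌋
  mor-λ⇐ S = inr-⊥ {⟦ S ⟧}

  mor-ρ : ∀ S → mor (𝓒M.ρ⇒ S) ≈ ρ⇒ ⌊ S ⌋
  mor-ρ S = copair-ρ {⟦ S ⟧}

  mor-ρ⇐ : ∀ S → mor (𝓒M.ρ⇐ S) ≈ ρ⇐ ⌊ S ⌋
  mor-ρ⇐ S = inl-⊥ {⟦ S ⟧}

  mor-β : ∀ S R → mor (𝓒M.β S R) ≈ β ⌊ S ⌋ ⌊ R ⌋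
  mor-β S R = copair-β {⟦ R ⟧} {⟦ S ⟧}

  -- Coclosedness.

  cohom-gen : ∀ A S → UniversalArrow (𝓒M.-⊕ S) (gen A)
  -- Since `gen A` is free on `A`, it suffices to find a universal arrow from `A` itself, along the
  -- composite with `forget`.
  cohom-gen A S = universal-descend (adjunction⇒universal generate⊣forget A) along-forget
    where
    open Coclosed coclosed
    module v = UniversalArrow
      (universal-⨾ (adjunction⇒universal (adjoint ⌊ S ⌋) A)
                   (adjunction⇒universal generate⊣forget (Functor.F₀ (-• ⌊ S ⌋) A)))

    -- Adding `S` and then forgetting agrees, up to `mor-⊕id`, with forgetting and then tensoring
    -- with `⌊ S ⌋`. Along the latter, `v` combines the cohom of the base category with the free
    -- algebra.
    along-forget : UniversalArrow ((𝓒M.-⊕ S) ⨾F forget) A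
    along-forget = record
      { obj = v.obj
      ; unit = v.unit
      ; lift = λ {Y} → v.lift {Y}
      ; commutes = λ {Y} {f} → ⨾-congˡ (mor-⊕id S (v.lift {Y} f)) ∙ v.commutes {Y} {f}
      ; unique = λ {Y} {g} {h} p → v.unique {Y} {g} {h}
          (sym (⨾-congˡ (mor-⊕id S g)) ∙ p ∙ ⨾-congˡ (mor-⊕id S h))
      }

  -- Objects are syntax trees rather than algebras with a property, so the universal arrow can be
  -- built by recursion on `R`.
  cohom : ∀ S R → UniversalArrow (𝓒M.-⊕ S) R
  cohom S ∅        = universal-𝟎 {R = 𝓒M.-⊕ S} freeSums-cocartesian freeSums-cocartesian
  cohom S (gen A)  = cohom-gen A S
  cohom S (R ⊞ R′) = universal-+ {R = 𝓒M.-⊕ S} freeSums-cocartesian freeSums-cocartesian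
                       {R} {R′} (cohom S R) (cohom S R′)

  freeSums-coclosed : Coclosed 𝓒M
  freeSums-coclosed = record
    { -•_ = λ S → leftAdjoint {R = 𝓒M.-⊕ S} (cohom S)
    ; adjoint = λ S → leftAdjoint-⊣ {R = 𝓒M.-⊕ S} (cohom S)
    }

  -- The symmetric comonoidal adjunction.

  H : SymmetricComonoidalFunctor symmetricMonoidalCategory 𝓒M
  H = record
    { comonoidalData = record { functor = generate ; m⊥ = r⊥ ; m = r }
    ; m-natural = λ f g →
        T.m-natural f g ∙ ⨾-congˡ (sym (mor-⊕₁ (generate₁ f) (generate₁ g)))
    ; m-assoc = λ {A} {B} {X} →
        ⨾-cong (⨾-congˡ (mor-⊕id (gen X) (r A B))) (mor-α (gen A) (gen B) (gen X))
        ∙ T.m-assoc ∙ ⨾-congˡ (sym (mor-id⊕ (gen A) (r B X)))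
    ; m-unitˡ = λ {A} →
        ⨾-congˡ (mor-⊕id (gen A) r⊥) ∙ T.m-unitˡ ∙ ⨾-congˡ (sym (mor-λ⇐ (gen A)))
    ; m-unitʳ = λ {A} →
        ⨾-congˡ (mor-id⊕ (gen A) r⊥) ∙ T.m-unitʳ ∙ ⨾-congˡ (sym (mor-ρ⇐ (gen A)))
    ; m-sym = λ {A} {B} → ⨾-congˡ (mor-β (gen A) (gen B)) ∙ T.m-sym
    }
    where
    open Functor generate renaming (F₁ to generate₁)

    -- Comonoidality of `μ` says exactly that the structure maps of `T` are algebra morphisms out of
    -- free algebras.
    r⊥ : Hom (gen ⊥) ∅
    r⊥ = record { mor = T.m⊥ ; isMor = record { commutes = sym (preserves-m⊥ μ-comonoidal) } }

    r : ∀ A B → Hom (gen (A ⊕ B)) (gen A ⊞ gen B)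
    r A B = record
      { mor = T.m A B ; isMor = record { commutes = sym assoc ∙ preserves-m μ-comonoidal } }

  -- Identities serve as structure maps because `⌊ S ⊞ R ⌋` and `⌊ ∅ ⌋` compute to `⌊ S ⌋ ⊕ ⌊ R ⌋`
  -- and `⊥`; the axioms are the `mor` equations.
  J : SymmetricComonoidalFunctor 𝓒M symmetricMonoidalCategory
  J = record
    { comonoidalData = record { functor = forget ; m⊥ = id ; m = λ _ _ → id }
    ; m-natural = λ f g → identityʳ ∙ mor-⊕₁ f g ∙ sym identityˡ
    ; m-assoc = λ {S} {R} {Q} → ⨾-congʳ (identityˡ ∙ ⊕-identity) ∙ identityˡ ∙ sym (mor-α S R Q)
                ∙ sym (⨾-cong identityʳ ⊕-identity ∙ identityʳ)
    ; m-unitˡ = λ {S} →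
        identityˡ ∙ ⊕-identity ∙ sym (⨾-congʳ (mor-λ S) ∙ _≅_.isoˡ (unitorˡ _))
    ; m-unitʳ = λ {S} →
        identityˡ ∙ ⊕-identity ∙ sym (⨾-congʳ (mor-ρ S) ∙ _≅_.isoˡ (unitorʳ _))
    ; m-sym = λ {S} {R} → identityˡ ∙ sym (identityʳ ∙ mor-β S R)
    }

  H⊣J : SymmetricComonoidalAdjunction symmetricMonoidalCategory 𝓒M
  H⊣J = record
    { H = H
    ; J = J
    ; adjunction = generate⊣forget
    ; unit-comonoidal = record
        { preserves-m = preserves-m η-comonoidal ∙ ⨾-congˡ (sym identityʳ)
        ; preserves-m⊥ = ⨾-congˡ identityʳ ∙ preserves-m⊥ η-comonoidal
        }
    ; counit-comonoidal = record
        -- The counit is the action, and the action on `S ⊞ R` is by definition `T.m` followed by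
        -- both actions.
        { preserves-m = λ {S} {R} →
            ⨾-cong (⨾-congʳ T.identity ∙ identityˡ) (mor-⊕₁ (ε S) (ε R)) ∙ sym identityʳ
        ; preserves-m⊥ = identityʳ ∙ sym (⨾-congʳ T.identity ∙ identityˡ)
        }
    }
    where ε = _⊣_.counit.η generate⊣forget

corollary35 : ∀ {o ℓ e : Level} (D : DualLinearCategory o ℓ e) →
    Σ[ M ∈ DualLNLModel o ℓ e (o ⊔ ℓ ⊔ e) (ℓ ⊔ e) e ]
    DualLNLModel.𝓛 M ≡ DualLinearCategory.𝓛 D
corollary35 D = record
  { 𝓛 = DualLinearCategory.𝓛 D
  ; 𝓒 = record { cocartesianCategory = 𝓒 ; coclosed = freeSums-coclosed }
  ; H⊣J = H⊣J
  } , ≡.refl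
  where open AlgebraSums D
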